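{- Let $X$ be a weighted graph on $n$ vertices, let $M\in\{A(X),L(X),Q(X)\}$ and $U(t)=e^{\mathrm{i}tM}$. Then $\epsilon$-uniform mixing occurs in $X$ (relative to $M$) if and only if there exists a sequence $\{\tau_m\}\subseteq\mathbb{R}$ such that $\lim_{m\to\infty}\sqrt{n}\,U(\tau_m)=\mathcal{H}$, where $\mathcal{H}$ is a symmetric complex Hadamard matrix. Additionally, if $M\in\{A(X),L(X)\}$, then $\mathcal{H}$ is non-dephased.
   Context: Graphs are finite, simple, undirected and connected, with positive real edge weights. $A(X)$ is the weighted adjacency matrix, $D(X)$ is the diagonal matrix of vertex degrees (degree = sum of weights of incident edges), $L(X)=D(X)-A(X)$, $Q(X)=D(X)+A(X)$. $\mathbf{e}_u$ is the characteristic vector of $u$, $\mathbf{1}$ the all-ones vector, $\circ$ the entrywise product. $\epsilon$-uniform mixing occurs in $X$ relative to $M$ if for each $\epsilon>0$ there is a $\tau\in\mathbb{R}$ such that $\big\|(U(\tau)\mathbf{e}_u)\circ(\overline{U(\tau)}\mathbf{e}_u)-\tfrac1n\mathbf{1}\big\|<\epsilon$ simultaneously for all vertices $u$ of $X$. An $n\times n$ matrix $\mathcal{H}$ is a complex Hadamard matrix if all its entries are complex numbers of modulus $1$ and $\mathcal{H}\overline{\mathcal{H}}^T=nI$. A complex Hadamard matrix is dephased if its first row and first column are all ones, and non-dephased otherwise.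
   Formalization: The "Additionally" clause (H is non-dephased for M = A(X) or L(X)) is stated for n ≥ 2; for the one-vertex graph A = L = [0], so U(t) = [1] and H = [1] is dephased. The equivalence is stated for all n ≥ 1. -}

module Defs where

open import Algebra.Bundles using (CommutativeRing)
open import Algebra.Bundles.Raw using (RawRing)
open import Axiom.ExcludedMiddle using (ExcludedMiddle)
open import Data.Fin.Base using (Fin; toℕ)
open import Data.Fin.Properties using (_≟_)
open import Data.Nat.Base as ℕ using (ℕ; zero; suc; _!)
open import Data.Product.Base using (∃; ∃-syntax; _×_; _,_)
open import Data.Sum.Base using (_⊎_)
open import Data.Vec.Functional using (Vector)
open import Level using (0ℓ)
open import Relation.Binary.Construct.Closure.ReflexiveTransitive using (Star)
open import Relation.Binary.Core using (Rel)
open import Relation.Binary.Definitions using (Decidable; Irreflexive; Symmetric)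
open import Relation.Binary.PropositionalEquality.Core using (_≡_)
open import Relation.Binary.Structures using (IsTotalOrder)
open import Relation.Nullary using (¬_; Dec; yes; no; does)
open import Relation.Unary using (Pred)
open import Data.Bool.Base using (if_then_else_)
import Algebra.Definitions.RawMonoid as RawMonoidDefinitions
import Relation.Binary.Construct.NonStrictToStrict as ToStrict

-- The real numbers are characterised, up to isomorphism, as a Dedekind
-- complete ordered field.  The value of _⁻¹ at 0# is unconstrained.
record CompleteOrderedField : Set₁ where
  infix 4 _≤_
  infix 9 _⁻¹
  field
    commutativeRing : CommutativeRing 0ℓ 0ℓ
  open CommutativeRing commutativeRing public
  field
    _⁻¹           : Carrier → Carrier
    0≉1           : ¬ 0# ≈ 1#
    *-inverseʳ    : ∀ x → ¬ x ≈ 0# → x * x ⁻¹ ≈ 1#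
    _≤_           : Rel Carrier 0ℓ
    isTotalOrder  : IsTotalOrder _≈_ _≤_
    +-monoʳ-≤     : ∀ x {y z} → y ≤ z → x + y ≤ x + z
    *-nonNegative : ∀ {x y} → 0# ≤ x → 0# ≤ y → 0# ≤ x * y

  IsUpperBound : Pred Carrier 0ℓ → Pred Carrier 0ℓ
  IsUpperBound S b = ∀ x → S x → x ≤ b

  field
    supremum : (S : Pred Carrier 0ℓ) → ∃ S → ∃ (IsUpperBound S) →
               ∃[ s ] IsUpperBound S s × (∀ b → IsUpperBound S b → s ≤ b)

  open ToStrict _≈_ _≤_ public using () renaming (_<_ to infix 4 _<_)

  open RawMonoidDefinitions +-rawMonoid public using (sum) renaming (_×_ to _·_)

  fromℕ : ℕ → Carrier
  fromℕ n = n · 1#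

module UniformMixing (em : ExcludedMiddle 0ℓ) (ℝ-field : CompleteOrderedField) where

  open CompleteOrderedField ℝ-field public using () renaming (Carrier to ℝ)
  private module ℝ = CompleteOrderedField ℝ-field

  -- An element satisfying P, or the given default if there is none.
  choose : {A : Set} → A → Pred A 0ℓ → A
  choose {A} default P = fromDec em
    where
    fromDec : Dec (∃ P) → A
    fromDec (yes (x , _)) = x
    fromDec (no _)        = default

  √ : ℝ → ℝ
  √ x = choose ℝ.0# (λ y → ℝ.0# ℝ.≤ y × y ℝ.* y ℝ.≈ x)

  infixl 6 _+ⅈ_
  record ℂ : Set where
    constructor _+ⅈ_
    field
      re im : ℝ
  open ℂ public

  ℂ-rawRing : RawRing 0ℓ 0ℓ
  ℂ-rawRing = record
    { Carrier = ℂ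
    ; _≈_     = λ z w → re z ℝ.≈ re w × im z ℝ.≈ im w
    ; _+_     = λ z w → (re z ℝ.+ re w) +ⅈ (im z ℝ.+ im w)
    ; _*_     = λ z w → (re z ℝ.* re w ℝ.- im z ℝ.* im w)
                        +ⅈ (re z ℝ.* im w ℝ.+ im z ℝ.* re w)
    ; -_      = λ z → (ℝ.- re z) +ⅈ (ℝ.- im z)
    ; 0#      = ℝ.0# +ⅈ ℝ.0#
    ; 1#      = ℝ.1# +ⅈ ℝ.0#
    }

  private module ℂ′ = RawRing ℂ-rawRing
  open ℂ′ using (_≈_; _+_; _*_; -_; 0#; 1#)
  open RawMonoidDefinitions ℂ′.+-rawMonoid using (sum)

  infixl 6 _-_
  _-_ : ℂ → ℂ → ℂ
  z - w = z + (- w)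

  fromℝ : ℝ → ℂ
  fromℝ x = x +ⅈ ℝ.0#

  ⅈ : ℂ
  ⅈ = ℝ.0# +ⅈ ℝ.1#

  conj : ℂ → ℂ
  conj z = re z +ⅈ (ℝ.- im z)

  ∣_∣² : ℂ → ℝ
  ∣ z ∣² = re z ℝ.* re z ℝ.+ im z ℝ.* im z

  ∣_∣ : ℂ → ℝ
  ∣ z ∣ = √ ∣ z ∣²

  infix 4 _⟶_
  _⟶_ : (ℕ → ℂ) → ℂ → Set
  z ⟶ l = ∀ ε → ℝ.0# ℝ.< ε → ∃[ N ] (∀ m → N ℕ.≤ m → ∣ z m - l ∣ ℝ.< ε)

  -- 0# if the sequence diverges.
  lim : (ℕ → ℂ) → ℂ
  lim z = choose 0# (z ⟶_)

  Matrix : Set → ℕ → Set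
  Matrix A n = Fin n → Fin n → A

  module _ {n : ℕ} where

    I : Matrix ℂ n
    I u v = if does (u ≟ v) then 1# else 0#

    infixl 7 _⊗_ _⊛_ _∘ᵥ_
    infixl 6 _-ᵥ_
    infixr 8 _^_

    _⊗_ : Matrix ℂ n → Matrix ℂ n → Matrix ℂ n
    (B ⊗ C) u v = sum (λ w → B u w * C w v)

    _^_ : Matrix ℂ n → ℕ → Matrix ℂ n
    B ^ zero  = I
    B ^ suc k = B ⊗ B ^ k

    _⊛_ : Matrix ℂ n → Vector ℂ n → Vector ℂ n
    (B ⊛ x) u = sum (λ v → B u v * x v)

    conjᴹ : Matrix ℂ n → Matrix ℂ n
    conjᴹ B u v = conj (B u v)

    _ᵀ : Matrix ℂ n → Matrix ℂ n
    (B ᵀ) u v = B v u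

    infixr 7 _∙ᴹ_
    _∙ᴹ_ : ℂ → Matrix ℂ n → Matrix ℂ n
    (c ∙ᴹ B) u v = c * B u v

    _≈ᴹ_ : Rel (Matrix ℂ n) 0ℓ
    B ≈ᴹ C = ∀ u v → B u v ≈ C u v

    -- The power series Σₖ Bᵏ / k!, entrywise.
    exp : Matrix ℂ n → Matrix ℂ n
    exp B u v = lim λ N → sum {N} λ k →
      fromℝ (ℝ.fromℕ (toℕ k !) ℝ.⁻¹) * (B ^ toℕ k) u v

    -- Convergence in the space of n × n matrices is entrywise convergence.
    _⟶ᴹ_ : (ℕ → Matrix ℂ n) → Matrix ℂ n → Set
    B ⟶ᴹ C = ∀ u v → (λ m → B m u v) ⟶ C u v

    𝐞 : Fin n → Vector ℂ n
    𝐞 u v = I u v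

    _∘ᵥ_ : Vector ℂ n → Vector ℂ n → Vector ℂ n
    (x ∘ᵥ y) v = x v * y v

    _-ᵥ_ : Vector ℂ n → Vector ℂ n → Vector ℂ n
    (x -ᵥ y) v = x v - y v

    constant : ℂ → Vector ℂ n
    constant c _ = c

    ‖_‖ : Vector ℂ n → ℝ
    ‖ x ‖ = √ (ℝ.sum (λ v → ∣ x v ∣²))

    SymmetricMatrix : Matrix ℂ n → Set
    SymmetricMatrix B = B ≈ᴹ (B ᵀ)

    IsComplexHadamard : Matrix ℂ n → Set
    IsComplexHadamard H =
      (∀ u v → ∣ H u v ∣ ℝ.≈ ℝ.1#) ×
      ((H ⊗ (conjᴹ H ᵀ)) ≈ᴹ (fromℝ (ℝ.fromℕ n) ∙ᴹ I))

    Dephased : Matrix ℂ n → Set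
    Dephased H = ∀ u v → toℕ u ≡ 0 ⊎ toℕ v ≡ 0 → H u v ≈ 1#

  -- weight u v is meaningful only for adjacent u and v.
  record WeightedGraph (n : ℕ) : Set₁ where
    field
      Adj             : Rel (Fin n) 0ℓ
      adj?            : Decidable Adj
      adj-sym         : Symmetric Adj
      adj-irrefl      : Irreflexive _≡_ Adj
      connected       : ∀ u v → Star Adj u v
      weight          : Fin n → Fin n → ℝ
      weight-sym      : ∀ {u v} → Adj u v → weight u v ℝ.≈ weight v u
      weight-positive : ∀ {u v} → Adj u v → ℝ.0# ℝ.< weight u v

    A : Matrix ℝ n
    A u v = if does (adj? u v) then weight u v else ℝ.0#

    degree : Fin n → ℝ
    degree u = ℝ.sum (A u)

    D : Matrix ℝ n
    D u v = if does (u ≟ v) then degree u else ℝ.0#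

    L : Matrix ℝ n
    L u v = D u v ℝ.- A u v

    Q : Matrix ℝ n
    Q u v = D u v ℝ.+ A u v

  data MatrixKind : Set where
    adjacency laplacian signlessLaplacian : MatrixKind

  module _ {n : ℕ} (X : WeightedGraph n) where

    matrix : MatrixKind → Matrix ℝ n
    matrix adjacency         = WeightedGraph.A X
    matrix laplacian         = WeightedGraph.L X
    matrix signlessLaplacian = WeightedGraph.Q X

    U : MatrixKind → ℝ → Matrix ℂ n
    U M t = exp ((ⅈ * fromℝ t) ∙ᴹ (λ u v → fromℝ (matrix M u v)))

    EpsilonUniformMixing : MatrixKind → Set
    EpsilonUniformMixing M = ∀ ε → ℝ.0# ℝ.< ε → ∃[ τ ] (∀ u →
      ‖ (U M τ ⊛ 𝐞 u) ∘ᵥ (conjᴹ (U M τ) ⊛ 𝐞 u)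
        -ᵥ constant (fromℝ (ℝ.fromℕ n ℝ.⁻¹)) ‖ ℝ.< ε)

    ScaledLimit : MatrixKind → (ℕ → ℝ) → Matrix ℂ n → Set
    ScaledLimit M τ H =
      (λ m → fromℝ (√ (ℝ.fromℕ n)) ∙ᴹ U M (τ m)) ⟶ᴹ H

-- U t is the exponential of a symmetric matrix with purely imaginary entries, hence symmetric and
-- unitary, and it commutes with M.  Mixing at ε = 2⁻ᵐ gives times τₘ at which all ∣U uv∣² tend to 1/n;
-- the entries stay bounded, so a subsequence of U (τₘ) converges, and √n times its limit is a symmetric
-- Hadamard matrix.  Conversely ∣H uv∣ = 1 forces ∣U (τₘ) uv∣² → 1/n.  A limit H commutes with M, so if
-- its first row and column consist of ones, then 𝟏ᵀM𝟏 = 𝟏ᵀMH𝐞₀ = 𝟏ᵀHM𝐞₀ = n M₀₀.  For the adjacency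
-- matrix this says that the total weight is 0, for the Laplacian that the first vertex has degree 0.
module Submission where

open import Defs
open import Algebra.Bundles using (CommutativeRing)
open import Algebra.Bundles.Raw using (RawRing)
open import Algebra.Solver.Ring.AlmostCommutativeRing using (_-Raw-AlmostCommutative⟶_; fromCommutativeRing)
open import Axiom.DoubleNegationElimination using (em⇒dne)
open import Axiom.ExcludedMiddle using (ExcludedMiddle)
open import Data.Bool.Base using (true; false; if_then_else_)
open import Data.Fin.Base using (Fin; zero; suc; toℕ)
open import Data.Fin.Properties using (_≟_)
open import Data.Integer.Base as ℤ using (ℤ; +_; -[1+_]; +0; +[1+_])
open import Data.Maybe.Base using (Maybe; just; nothing)
open import Data.Nat.Base as ℕ using (ℕ; zero; suc; NonZero; z≤n; s≤s; _!)
open import Data.Product.Base using (∃; ∃-syntax; _×_; _,_; proj₁; proj₂)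
open import Data.Sum.Base using (_⊎_; inj₁; inj₂)
open import Function.Base using (_∘_)
open import Function.Bundles using (_⇔_; mk⇔)
open import Level using (0ℓ)
open import Relation.Binary.Construct.Closure.ReflexiveTransitive as Star using (Star; _◅_)
open import Relation.Binary.PropositionalEquality.Core as ≡ using (_≡_)
open import Relation.Binary.Structures using (IsTotalOrder)
open import Relation.Nullary using (¬_; yes; no; does; contradiction)
open import Relation.Unary using (Pred)
import Algebra.Properties.AbelianGroup
import Algebra.Properties.Ring
import Algebra.Properties.Semiring.Exp
import Algebra.Properties.Semiring.Mult
import Algebra.Properties.Semiring.Mult.TCOptimised
import Algebra.Properties.Semiring.Sum
import Algebra.Solver.Ring
import Data.Integer.Properties as ℤ
import Data.Nat.Properties as ℕ
import Relation.Binary.Construct.NonStrictToStrict as ToStrict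
import Relation.Binary.Reasoning.Setoid

-- `exp` is a `lim` with a default value, so nothing can be said about `U` before its power series
-- is shown to converge. The harder point is unitarity, exp B · exp (-B) = I, obtained as a Cauchy
-- product. For each entry, the N × N square of terms (Bʲ⁺ᵏ)ᵤᵥ αⱼ βₖ is compared with the triangle j
-- + k < N. All diagonals j + k = d with d > 0 vanish, so a nonempty triangle equals I exactly, and
-- only the distance from square to triangle has to tend to 0. For this the terms are bounded by C
-- ¼ʲ ½ᵏ, with unequal rates, which makes that distance a multiple of ½ᴺ. Estimates are kept in a
-- form accessible to ring identities: `_∈±_` expresses ∣x∣ ≤ c by two nonnegative differences, and
-- `Bounded` bounds the real and imaginary parts of a complex number. Moduli and norms are
-- translated into `Bounded` on entering the argument and back on leaving it. The contradiction for
-- a dephased limit comes from a second vertex: connectedness then gives the first vertex positive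
-- degree.

module IntegerCoefficientSolver (R : CommutativeRing 0ℓ 0ℓ) where

  open CommutativeRing R
  open Algebra.Properties.AbelianGroup +-abelianGroup using (⁻¹-∙-comm; ε⁻¹≈ε; ⁻¹-involutive)
  open Algebra.Properties.Ring ring using (-‿distribˡ-*; -‿distribʳ-*)
  open Algebra.Properties.Semiring.Mult.TCOptimised semiring using (1+×; ×-homo-+; ×1-homo-*) renaming (_×_ to _·_)
  open Relation.Binary.Reasoning.Setoid setoid

  -- With this form of multiple, `+ 1` denotes `1#` itself and not `1# + 0#`, so that `con (+ 1)` in
  -- a solver equation matches a literal `1#` in the goal.
  fromℤ : ℤ → Carrier
  fromℤ (+ n)    = n · 1#
  fromℤ -[1+ n ] = - (suc n · 1#)

  fromℤ-neg : ∀ i → fromℤ (ℤ.- i) ≈ - fromℤ i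
  fromℤ-neg +0       = sym ε⁻¹≈ε
  fromℤ-neg +[1+ n ] = refl
  fromℤ-neg -[1+ n ] = sym (⁻¹-involutive _)

  fromℤ-⊖ : ∀ m n → fromℤ (m ℤ.⊖ n) ≈ m · 1# - n · 1#
  fromℤ-⊖ zero    zero    = sym (-‿inverseʳ _)
  fromℤ-⊖ zero    (suc n) = sym (+-identityˡ _)
  fromℤ-⊖ (suc m) zero    = trans (sym (+-identityʳ _)) (+-congˡ (sym ε⁻¹≈ε))
  fromℤ-⊖ (suc m) (suc n) = begin
    fromℤ (suc m ℤ.⊖ suc n)                ≡⟨ ≡.cong fromℤ (ℤ.[1+m]⊖[1+n]≡m⊖n m n) ⟩
    fromℤ (m ℤ.⊖ n)                        ≈⟨ fromℤ-⊖ m n ⟩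
    m · 1# - n · 1#                        ≈⟨ +-congˡ (+-identityˡ _) ⟨
    m · 1# + (0# - n · 1#)                 ≈⟨ +-congˡ (+-congʳ (-‿inverseʳ 1#)) ⟨
    m · 1# + (1# - 1# - n · 1#)            ≈⟨ +-congˡ (+-assoc _ _ _) ⟩
    m · 1# + (1# + (- 1# - n · 1#))        ≈⟨ +-assoc _ _ _ ⟨
    m · 1# + 1# + (- 1# - n · 1#)          ≈⟨ +-cong (+-comm _ _) (⁻¹-∙-comm _ _) ⟩
    1# + m · 1# - (1# + n · 1#)            ≈⟨ +-cong (1+× m 1#) (-‿cong (1+× n 1#)) ⟨
    suc m · 1# - suc n · 1#                ∎

  fromℤ-+ : ∀ i j → fromℤ (i ℤ.+ j) ≈ fromℤ i + fromℤ j
  fromℤ-+ (+ m)    (+ n)    = ×-homo-+ 1# m n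
  fromℤ-+ (+ m)    -[1+ n ] = fromℤ-⊖ m (suc n)
  fromℤ-+ -[1+ m ] (+ n)    = trans (fromℤ-⊖ n (suc m)) (+-comm _ _)
  fromℤ-+ -[1+ m ] -[1+ n ] = begin
    - (suc (suc (m ℕ.+ n)) · 1#)      ≈⟨ -‿cong (1+× (suc (m ℕ.+ n)) 1#) ⟩
    - (1# + (suc m ℕ.+ n) · 1#)       ≈⟨ -‿cong (+-congˡ (×-homo-+ 1# (suc m) n)) ⟩
    - (1# + (suc m · 1# + n · 1#))    ≈⟨ -‿cong (+-assoc _ _ _) ⟨
    - (1# + suc m · 1# + n · 1#)      ≈⟨ -‿cong (+-congʳ (+-comm _ _)) ⟩
    - (suc m · 1# + 1# + n · 1#)      ≈⟨ -‿cong (+-assoc _ _ _) ⟩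
    - (suc m · 1# + (1# + n · 1#))    ≈⟨ -‿cong (+-congˡ (1+× n 1#)) ⟨
    - (suc m · 1# + suc n · 1#)       ≈⟨ ⁻¹-∙-comm _ _ ⟨
    - (suc m · 1#) - suc n · 1#       ∎

  fromℤ-pos-* : ∀ m n → fromℤ (+ m ℤ.* + n) ≈ m · 1# * n · 1#
  fromℤ-pos-* m n = trans (reflexive (≡.cong fromℤ (≡.sym (ℤ.pos-* m n)))) (×1-homo-* m n)

  fromℤ-nonNegative-* : ∀ m j → fromℤ (+ m ℤ.* j) ≈ m · 1# * fromℤ j
  fromℤ-nonNegative-* m (+ n)    = fromℤ-pos-* m n
  fromℤ-nonNegative-* m -[1+ n ] = begin
    fromℤ (+ m ℤ.* -[1+ n ])         ≡⟨ ≡.cong fromℤ (ℤ.neg-distribʳ-* (+ m) (+ suc n)) ⟨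
    fromℤ (ℤ.- (+ m ℤ.* + suc n))    ≈⟨ fromℤ-neg (+ m ℤ.* + suc n) ⟩
    - fromℤ (+ m ℤ.* + suc n)        ≈⟨ -‿cong (fromℤ-pos-* m (suc n)) ⟩
    - (m · 1# * suc n · 1#)          ≈⟨ -‿distribʳ-* _ _ ⟩
    m · 1# * - (suc n · 1#)          ∎

  fromℤ-* : ∀ i j → fromℤ (i ℤ.* j) ≈ fromℤ i * fromℤ j
  fromℤ-* (+ m)    j = fromℤ-nonNegative-* m j
  fromℤ-* -[1+ m ] j = begin
    fromℤ (-[1+ m ] ℤ.* j)         ≡⟨ ≡.cong fromℤ (ℤ.neg-distribˡ-* (+ suc m) j) ⟨
    fromℤ (ℤ.- (+ suc m ℤ.* j))    ≈⟨ fromℤ-neg (+ suc m ℤ.* j) ⟩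
    - fromℤ (+ suc m ℤ.* j)        ≈⟨ -‿cong (fromℤ-nonNegative-* (suc m) j) ⟩
    - (suc m · 1# * fromℤ j)       ≈⟨ -‿distribˡ-* _ _ ⟩
    - (suc m · 1#) * fromℤ j       ∎

  fromℤ-homomorphism : ℤ.+-*-rawRing -Raw-AlmostCommutative⟶ fromCommutativeRing R
  fromℤ-homomorphism = record
    { ⟦_⟧    = fromℤ
    ; +-homo = fromℤ-+
    ; *-homo = fromℤ-*
    ; -‿homo = fromℤ-neg
    ; 0-homo = refl
    ; 1-homo = refl
    }

  fromℤ≟ : ∀ i j → Maybe (fromℤ i ≈ fromℤ j)
  fromℤ≟ i j with i ℤ.≟ j
  ... | yes i≡j = just (reflexive (≡.cong fromℤ i≡j))
  ... | no  _   = nothing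

  open Algebra.Solver.Ring ℤ.+-*-rawRing (fromCommutativeRing R) fromℤ-homomorphism fromℤ≟ public
    using (solve; con; _:+_; _:*_; _:-_; :-_; _:=_)

-- Real analysis in a complete ordered field.

module RealAnalysis (em : ExcludedMiddle 0ℓ) (F : CompleteOrderedField) where

  open CompleteOrderedField F public
  open IsTotalOrder isTotalOrder public
    using (antisym; total; ≤-respˡ-≈; ≤-respʳ-≈)
    renaming (reflexive to ≤-reflexive; refl to ≤-refl; trans to ≤-trans)
  open IntegerCoefficientSolver commutativeRing public
  open Algebra.Properties.Ring ring public using (-0#≈0#)
  open Algebra.Properties.Semiring.Exp semiring public using () renaming (_^_ to _^ʳ_)

  module ≈-Reasoning = Relation.Binary.Reasoning.Setoid setoid

  dne : {P : Set} → ¬ ¬ P → P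
  dne = em⇒dne em

  <⇒≤ : ∀ {x y} → x < y → x ≤ y
  <⇒≤ = proj₁

  <⇒≱ : ∀ {x y} → x < y → ¬ y ≤ x
  <⇒≱ = ToStrict.<⇒≱ _≈_ _≤_ antisym

  ≰⇒> : ∀ {x y} → ¬ x ≤ y → y < x
  ≰⇒> = ToStrict.≰⇒> _≈_ _≤_ sym ≤-reflexive total

  x≤y⇒0≤y-x : ∀ {x y} → x ≤ y → 0# ≤ y - x
  x≤y⇒0≤y-x {x} {y} x≤y =
    ≤-respʳ-≈ (+-comm (- x) y) (≤-respˡ-≈ (-‿inverseˡ x) (+-monoʳ-≤ (- x) x≤y))

  -- Splits an inequality into a ring identity for the difference, left to the solver, and a sign,
  -- built from sums and products of nonnegative terms. Most inequalities below are proved this way.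
  ≤-by : ∀ {x y z} → y - x ≈ z → 0# ≤ z → x ≤ y
  ≤-by {x} {y} eq 0≤z =
    ≤-respʳ-≈ (trans (+-congˡ (sym eq)) (solve 2 (λ x y → x :+ (y :- x) := y) refl x y))
      (≤-respˡ-≈ (+-identityʳ x) (+-monoʳ-≤ x 0≤z))

  0≤x+y : ∀ {x y} → 0# ≤ x → 0# ≤ y → 0# ≤ x + y
  0≤x+y {x} {y} 0≤x 0≤y =
    ≤-trans 0≤x (≤-by (solve 2 (λ x y → x :+ y :- x := y) refl x y) 0≤y)

  +-mono-≤ : ∀ {w x y z} → w ≤ x → y ≤ z → w + y ≤ x + z
  +-mono-≤ {w} {x} {y} {z} w≤x y≤z =
    ≤-by (solve 4 (λ w x y z → x :+ z :- (w :+ y) := (x :- w) :+ (z :- y)) refl w x y z)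
      (0≤x+y (x≤y⇒0≤y-x w≤x) (x≤y⇒0≤y-x y≤z))

  *-monoʳ-≤ : ∀ {x y z} → 0# ≤ x → y ≤ z → x * y ≤ x * z
  *-monoʳ-≤ {x} {y} {z} 0≤x y≤z =
    ≤-by (solve 3 (λ x y z → x :* z :- x :* y := x :* (z :- y)) refl x y z)
      (*-nonNegative 0≤x (x≤y⇒0≤y-x y≤z))

  *-monoˡ-≤ : ∀ {x y z} → 0# ≤ x → y ≤ z → y * x ≤ z * x
  *-monoˡ-≤ {x} {y} {z} 0≤x y≤z =
    ≤-respˡ-≈ (*-comm x y) (≤-respʳ-≈ (*-comm x z) (*-monoʳ-≤ 0≤x y≤z))

  *-mono-≤ : ∀ {w x y z} → 0# ≤ x → 0# ≤ y → w ≤ x → y ≤ z → w * y ≤ x * z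
  *-mono-≤ 0≤x 0≤y w≤x y≤z = ≤-trans (*-monoˡ-≤ 0≤y w≤x) (*-monoʳ-≤ 0≤x y≤z)

  0≤x*x : ∀ x → 0# ≤ x * x
  0≤x*x x with total 0# x
  ... | inj₁ 0≤x = *-nonNegative 0≤x 0≤x
  ... | inj₂ x≤0 =
    ≤-respʳ-≈ (solve 1 (λ x → (con +0 :- x) :* (con +0 :- x) := x :* x) refl x)
      (*-nonNegative (x≤y⇒0≤y-x x≤0) (x≤y⇒0≤y-x x≤0))

  0≤1 : 0# ≤ 1#
  0≤1 = ≤-respʳ-≈ (*-identityˡ 1#) (0≤x*x 1#)

  0<1 : 0# < 1#
  0<1 = 0≤1 , 0≉1

  0<x+y : ∀ {x y} → 0# < x → 0# ≤ y → 0# < x + y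
  0<x+y {x} {y} 0<x 0≤y = ≰⇒> λ x+y≤0 → <⇒≱ 0<x
    (≤-trans (≤-by (solve 2 (λ x y → x :+ y :- x := y) refl x y) 0≤y) x+y≤0)

  0<⇒≉0 : ∀ {x} → 0# < x → ¬ x ≈ 0#
  0<⇒≉0 (_ , 0≉x) x≈0 = 0≉x (sym x≈0)

  *-inverseˡ : ∀ {x} → ¬ x ≈ 0# → x ⁻¹ * x ≈ 1#
  *-inverseˡ {x} x≉0 = trans (*-comm _ _) (*-inverseʳ x x≉0)

  *-cancelˡ : ∀ {x y z} → ¬ x ≈ 0# → x * y ≈ x * z → y ≈ z
  *-cancelˡ {x} {y} {z} x≉0 eq = begin
    y                 ≈⟨ *-identityˡ y ⟨
    1# * y            ≈⟨ *-congʳ (*-inverseˡ x≉0) ⟨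
    x ⁻¹ * x * y      ≈⟨ *-assoc _ _ _ ⟩
    x ⁻¹ * (x * y)    ≈⟨ *-congˡ eq ⟩
    x ⁻¹ * (x * z)    ≈⟨ *-assoc _ _ _ ⟨
    x ⁻¹ * x * z      ≈⟨ *-congʳ (*-inverseˡ x≉0) ⟩
    1# * z            ≈⟨ *-identityˡ z ⟩
    z                 ∎
    where open ≈-Reasoning

  0<x*y : ∀ {x y} → 0# < x → 0# < y → 0# < x * y
  0<x*y {x} {y} 0<x 0<y = *-nonNegative (<⇒≤ 0<x) (<⇒≤ 0<y) ,
    λ 0≈xy → 0<⇒≉0 0<y (*-cancelˡ (0<⇒≉0 0<x) (trans (sym 0≈xy) (sym (zeroʳ x))))

  *-cancelˡ-≤ : ∀ {x y z} → 0# < x → x * y ≤ x * z → y ≤ z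
  *-cancelˡ-≤ {x} {y} {z} 0<x xy≤xz = dne λ y≰z → z≮y (≰⇒> y≰z)
    where
    z≮y : ¬ z < y
    z≮y (z≤y , z≉y) = z≉y (*-cancelˡ (0<⇒≉0 0<x) (antisym (*-monoʳ-≤ (<⇒≤ 0<x) z≤y) xy≤xz))

  0<x⁻¹ : ∀ {x} → 0# < x → 0# < x ⁻¹
  0<x⁻¹ {x} 0<x =
    *-cancelˡ-≤ 0<x
      (≤-respˡ-≈ (sym (zeroʳ x)) (≤-respʳ-≈ (sym (*-inverseʳ x (0<⇒≉0 0<x))) 0≤1)) ,
    λ 0≈x⁻¹ → 0≉1 (trans (sym (zeroʳ x)) (trans (*-congˡ 0≈x⁻¹) (*-inverseʳ x (0<⇒≉0 0<x))))

  0<2 : 0# < 1# + 1#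
  0<2 = 0<x+y 0<1 0≤1

  ½ : Carrier
  ½ = (1# + 1#) ⁻¹

  0<½ : 0# < ½
  0<½ = 0<x⁻¹ 0<2

  ½+½≈1 : ½ + ½ ≈ 1#
  ½+½≈1 = trans (solve 1 (λ h → h :+ h := (con (+ 1) :+ con (+ 1)) :* h) refl ½)
    (*-inverseʳ _ (0<⇒≉0 0<2))

  ½x+½x≈x : ∀ x → ½ * x + ½ * x ≈ x
  ½x+½x≈x x = trans (sym (distribʳ x ½ ½)) (trans (*-congʳ ½+½≈1) (*-identityˡ x))

  halve-≤ : ∀ {x y} → x + x ≤ y + y → x ≤ y
  halve-≤ {x} {y} 2x≤2y = *-cancelˡ-≤ 0<2 (≤-respˡ-≈ (double x) (≤-respʳ-≈ (double y) 2x≤2y))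
    where
    double : ∀ x → x + x ≈ (1# + 1#) * x
    double = solve 1 (λ x → x :+ x := (con (+ 1) :+ con (+ 1)) :* x) refl

  ≤-squares : ∀ {x y} → 0# ≤ y → x * x ≤ y * y → x ≤ y
  ≤-squares {x} {y} 0≤y x²≤y² = dne λ x≰y → <⇒≱ (y²<x² (≰⇒> x≰y)) x²≤y²
    where
    y²<x² : y < x → y * y < x * x
    -- If y < x and x² ≤ y², then -(x - y)² = (y² - x²) + 2y(x - y) is nonnegative, although (x -
    -- y)² is positive.
    y²<x² y<x@(y≤x , _) = ≰⇒> λ x²≤y² → <⇒≱ (0<x*y 0<x-y 0<x-y)
      (≤-by (solve 2 (λ x y → con +0 :- (x :- y) :* (x :- y) := (y :* y :- x :* x) :+ (y :* (x :- y) :+ y :* (x :- y))) refl x y)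
        (0≤x+y (x≤y⇒0≤y-x x²≤y²)
          (0≤x+y (*-nonNegative 0≤y (x≤y⇒0≤y-x y≤x)) (*-nonNegative 0≤y (x≤y⇒0≤y-x y≤x)))))
      where
      0<x-y : 0# < x - y
      0<x-y = x≤y⇒0≤y-x y≤x , λ 0≈x-y → proj₂ y<x
        (trans (sym (+-identityˡ y)) (trans (+-congʳ 0≈x-y) (solve 2 (λ x y → x :- y :+ y := x) refl x y)))

  -- The bound ∣x∣ ≤ c, in a form on which the ring solver can act.
  infix 4 _∈±_
  _∈±_ : Carrier → Carrier → Set
  x ∈± c = 0# ≤ c + x × 0# ≤ c - x

  ∈±-resp-≈ : ∀ {x y c} → x ≈ y → x ∈± c → y ∈± c
  ∈±-resp-≈ x≈y (p , q) = ≤-respʳ-≈ (+-congˡ x≈y) p , ≤-respʳ-≈ (+-congˡ (-‿cong x≈y)) q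

  ∈±-weaken : ∀ {x c d} → c ≤ d → x ∈± c → x ∈± d
  ∈±-weaken c≤d (p , q) = ≤-trans p (+-mono-≤ c≤d ≤-refl) , ≤-trans q (+-mono-≤ c≤d ≤-refl)

  0∈± : ∀ {c} → 0# ≤ c → 0# ∈± c
  0∈± {c} 0≤c = ≤-respʳ-≈ (sym (+-identityʳ c)) 0≤c ,
    ≤-respʳ-≈ (solve 1 (λ c → c := c :- con +0) refl c) 0≤c

  ∈±-neg : ∀ {x c} → x ∈± c → - x ∈± c
  ∈±-neg {x} {c} (p , q) = q , ≤-respʳ-≈ (solve 2 (λ x c → c :+ x := c :- (:- x)) refl x c) p

  ∈±-+ : ∀ {x y c d} → x ∈± c → y ∈± d → x + y ∈± c + d
  ∈±-+ {x} {y} {c} {d} (p , q) (r , s) =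
    ≤-respʳ-≈ (solve 4 (λ x y c d → (c :+ x) :+ (d :+ y) := c :+ d :+ (x :+ y)) refl x y c d) (0≤x+y p r) ,
    ≤-respʳ-≈ (solve 4 (λ x y c d → (c :- x) :+ (d :- y) := c :+ d :- (x :+ y)) refl x y c d) (0≤x+y q s)

  -- Twice the differences cd ± xy are sums of products of the four nonnegative numbers c ± x and d
  -- ± y.
  ∈±-* : ∀ {x y c d} → x ∈± c → y ∈± d → x * y ∈± c * d
  ∈±-* {x} {y} {c} {d} (p , q) (r , s) =
    halve-≤ (≤-by (solve 4 (λ x y c d → c :* d :+ x :* y :+ (c :* d :+ x :* y) :- (con +0 :+ con +0)
                        := (c :+ x) :* (d :+ y) :+ (c :- x) :* (d :- y)) refl x y c d)
               (0≤x+y (*-nonNegative p r) (*-nonNegative q s))) ,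
    halve-≤ (≤-by (solve 4 (λ x y c d → c :* d :- x :* y :+ (c :* d :- x :* y) :- (con +0 :+ con +0)
                        := (c :+ x) :* (d :- y) :+ (c :- x) :* (d :+ y)) refl x y c d)
               (0≤x+y (*-nonNegative p s) (*-nonNegative q r)))

  0≤x∈±x : ∀ {x} → 0# ≤ x → x ∈± x
  0≤x∈±x {x} 0≤x = 0≤x+y 0≤x 0≤x , ≤-reflexive (sym (-‿inverseʳ x))

  ∈±⇒0≤ : ∀ {x c} → x ∈± c → 0# ≤ c
  ∈±⇒0≤ {x} {c} (p , q) = halve-≤
    (≤-by (solve 2 (λ x c → c :+ c :- (con +0 :+ con +0) := (c :+ x) :+ (c :- x)) refl x c) (0≤x+y p q))

  x²≤c²⇒x∈±c : ∀ {x c} → 0# ≤ c → x * x ≤ c * c → x ∈± c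
  x²≤c²⇒x∈±c {x} {c} 0≤c x²≤c² =
    ≤-respʳ-≈ (solve 2 (λ x c → c :- (:- x) := c :+ x) refl x c)
      (x≤y⇒0≤y-x (≤-squares 0≤c (≤-respˡ-≈ (solve 1 (λ x → x :* x := (:- x) :* (:- x)) refl x) x²≤c²))) ,
    x≤y⇒0≤y-x (≤-squares 0≤c x²≤c²)

  x∈±c⇒x²≤c² : ∀ {x c} → x ∈± c → x * x ≤ c * c
  x∈±c⇒x²≤c² {x} {c} (p , q) = ≤-by
    (solve 2 (λ x c → c :* c :- x :* x := (c :+ x) :* (c :- x)) refl x c) (*-nonNegative p q)

  ∃∈± : ∀ x → ∃[ c ] x ∈± c
  ∃∈± x with total 0# x
  ... | inj₁ 0≤x = x , 0≤x∈±x 0≤x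
  ... | inj₂ x≤0 = - x ,
    (≤-reflexive (sym (-‿inverseˡ x)) , 0≤x+y 0≤-x 0≤-x)
    where
    0≤-x : 0# ≤ - x
    0≤-x = ≤-respʳ-≈ (+-identityˡ (- x)) (x≤y⇒0≤y-x x≤0)

  ≤ε⇒≤0 : ∀ {x} → (∀ ε → 0# < ε → x ≤ ε) → x ≤ 0#
  ≤ε⇒≤0 {x} small = dne λ x≰0 → <⇒≱ (0<½x x≰0)
    (≤-by (trans (solve 2 (λ x y → con +0 :- y := y :- (y :+ y)) refl x (½ * x)) (+-congˡ (-‿cong (½x+½x≈x x))))
      (x≤y⇒0≤y-x (small (½ * x) (0<½x x≰0))))
    where
    0<½x : ¬ x ≤ 0# → 0# < ½ * x
    0<½x x≰0 = 0<x*y 0<½ (≰⇒> x≰0)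

  ∈±⇒≤ : ∀ {x c} → x ∈± c → x ≤ c
  ∈±⇒≤ (_ , q) = ≤-by refl q

  ∈±ε⇒≈0 : ∀ {x} → (∀ ε → 0# < ε → x ∈± ε) → x ≈ 0#
  ∈±ε⇒≈0 {x} small = antisym
    (≤ε⇒≤0 (λ ε 0<ε → ∈±⇒≤ (small ε 0<ε)))
    (≤-respʳ-≈ (solve 1 (λ x → con +0 :- (:- x) := x) refl x)
      (x≤y⇒0≤y-x (≤ε⇒≤0 (λ ε 0<ε → ∈±⇒≤ (∈±-neg (small ε 0<ε))))))

  0≤fromℕ : ∀ n → 0# ≤ fromℕ n
  0≤fromℕ zero    = ≤-refl
  0≤fromℕ (suc n) = 0≤x+y 0≤1 (0≤fromℕ n)

  0<fromℕ : ∀ n .{{_ : NonZero n}} → 0# < fromℕ n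
  0<fromℕ (suc n) = 0<x+y 0<1 (0≤fromℕ n)

  fromℕ-mono-≤ : ∀ {m n} → m ℕ.≤ n → fromℕ m ≤ fromℕ n
  fromℕ-mono-≤ {n = n} z≤n = 0≤fromℕ n
  fromℕ-mono-≤ (s≤s m≤n)   = +-monoʳ-≤ 1# (fromℕ-mono-≤ m≤n)

  -- If `x` lay above every natural number, these would have a supremum `s`; from n + 1 ≤ s for all
  -- n, the smaller number s - 1 would also be an upper bound.
  archimedean : ∀ x → ∃[ n ] x ≤ fromℕ n
  archimedean x = dne λ unbounded →
    let S y = ∃[ n ] y ≈ fromℕ n
        (s , s-upper , s-least) = supremum S (0# , 0 , refl)
          (x , λ { y (n , y≈n) → ≤-respˡ-≈ (sym y≈n) (<⇒≤ (≰⇒> λ x≤n → unbounded (n , x≤n))) })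
        upper = λ { y (n , y≈n) → ≤-by (trans (+-congˡ (-‿cong y≈n))
          (solve 3 (λ s o n → s :- o :- n := s :- (o :+ n)) refl s 1# (fromℕ n)))
          (x≤y⇒0≤y-x (s-upper (fromℕ (suc n)) (suc n , refl))) }
    in <⇒≱ 0<1 (≤-by (solve 2 (λ s o → con +0 :- o := s :- o :- s) refl s 1#) (x≤y⇒0≤y-x (s-least (s - 1#) upper)))

  0<½^ : ∀ n → 0# < ½ ^ʳ n
  0<½^ zero    = 0<1
  0<½^ (suc n) = 0<x*y 0<½ (0<½^ n)

  ½^-suc-≤ : ∀ n → ½ ^ʳ suc n ≤ ½ ^ʳ n
  ½^-suc-≤ n = ≤-by (trans (+-congʳ (sym (½x+½x≈x (½ ^ʳ n))))
      (solve 1 (λ x → x :+ x :- x := x) refl (½ ^ʳ suc n))) (<⇒≤ (0<½^ (suc n)))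

  ½^-antimono-≤ : ∀ {m n} → m ℕ.≤′ n → ½ ^ʳ n ≤ ½ ^ʳ m
  ½^-antimono-≤ ℕ.≤′-refl = ≤-refl
  ½^-antimono-≤ {n = suc n} (ℕ.≤′-step m≤n) = ≤-trans (½^-suc-≤ n) (½^-antimono-≤ m≤n)

  -- The supremum s of the lower bounds of all powers satisfies s + s ≤ s.
  ½^-small : ∀ ε → 0# < ε → ∃[ N ] ∀ n → N ℕ.≤ n → ½ ^ʳ n ≤ ε
  ½^-small ε 0<ε =
    let (N , ½^N≤ε) = dne λ large → <⇒≱ 0<ε (≤-trans (s-upper ε (λ n → <⇒≤ (≰⇒> λ p → large (n , p)))) s≤0)
    in N , λ n N≤n → ≤-trans (½^-antimono-≤ (ℕ.≤⇒≤′ N≤n)) ½^N≤ε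
    where
    S : Pred Carrier 0ℓ
    S x = ∀ n → x ≤ ½ ^ʳ n
    sup = supremum S (0# , λ n → <⇒≤ (0<½^ n)) (1# , λ x x∈S → x∈S 0)
    s = proj₁ sup
    s-upper = proj₁ (proj₂ sup)
    s-least = proj₂ (proj₂ sup)

    s≤½^ : ∀ n → s ≤ ½ ^ʳ n
    s≤½^ n = s-least _ (λ x x∈S → x∈S n)

    s+s≤s : s + s ≤ s
    s+s≤s = s-upper (s + s) λ n → ≤-respʳ-≈ (½x+½x≈x (½ ^ʳ n)) (+-mono-≤ (s≤½^ (suc n)) (s≤½^ (suc n)))

    s≤0 : s ≤ 0#
    s≤0 = ≤-by (solve 1 (λ s → con +0 :- s := s :- (s :+ s)) refl s) (x≤y⇒0≤y-x s+s≤s)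

  -- The supremum of the numbers exceeded infinitely often.
  cluster-point : ∀ (x : ℕ → Carrier) c → (∀ m → x m ∈± c) →
                  ∃[ s ] ∀ ε → 0# < ε → ∀ N → ∃[ m ] N ℕ.≤ m × x m - s ∈± ε
  cluster-point x c bounded = s , near
    where
    S : Pred Carrier 0ℓ
    S a = ∀ N → ∃[ m ] N ℕ.≤ m × a ≤ x m
    sup = supremum S
      (- c , λ N → N , ℕ.≤-refl , ≤-by (solve 2 (λ x c → x :- (:- c) := c :+ x) refl (x N) c) (proj₁ (bounded N)))
      (c , λ a a∈S → let (m , _ , a≤xm) = a∈S 0 in ≤-trans a≤xm (∈±⇒≤ (bounded m)))
    s = proj₁ sup
    s-upper = proj₁ (proj₂ sup)
    s-least = proj₂ (proj₂ sup)

    module _ (ε : Carrier) (0<ε : 0# < ε) where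

      -- Otherwise `s + ε` is itself reached infinitely often and belongs to `S`, above its
      -- supremum. Dually, if `above` failed, `s - ε` would be an upper bound of `S`.
      eventually-below : ∃[ N ] ∀ m → N ℕ.≤ m → x m < s + ε
      eventually-below = dne λ never → <⇒≱ 0<ε
        (≤-by (solve 2 (λ s e → con +0 :- e := s :- (s :+ e)) refl s ε)
          (x≤y⇒0≤y-x (s-upper (s + ε) λ N → dne λ none → never
            (N , λ m N≤m → ≰⇒> λ s+ε≤xm → none (m , N≤m , s+ε≤xm)))))

      above : ∃[ a ] S a × s - ε ≤ a
      above = dne λ none → <⇒≱ 0<ε
        (≤-by (solve 2 (λ s e → con +0 :- e := s :- e :- s) refl s ε)
          (x≤y⇒0≤y-x (s-least (s - ε) λ a a∈S → <⇒≤ (≰⇒> λ s-ε≤a → none (a , a∈S , s-ε≤a)))))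

      near : ∀ N → ∃[ m ] N ℕ.≤ m × x m - s ∈± ε
      near N =
        let (N′ , below)       = eventually-below
            (a , a∈S , s-ε≤a)  = above
            (m , N⊔N′≤m , a≤xm) = a∈S (N ℕ.⊔ N′)
        in m , ℕ.≤-trans (ℕ.m≤m⊔n N N′) N⊔N′≤m ,
           ≤-respʳ-≈ (solve 3 (λ x s e → x :- (s :- e) := e :+ (x :- s)) refl (x m) s ε)
             (x≤y⇒0≤y-x (≤-trans s-ε≤a a≤xm)) ,
           ≤-respʳ-≈ (solve 3 (λ x s e → s :+ e :- x := e :- (x :- s)) refl (x m) s ε)
             (x≤y⇒0≤y-x (<⇒≤ (below m (ℕ.≤-trans (ℕ.m≤n⊔m N N′) N⊔N′≤m))))

  ∈±+ε⇒∈± : ∀ {x c} → (∀ ε → 0# < ε → x ∈± c + ε) → x ∈± c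
  ∈±+ε⇒∈± {x} {c} h = weaken (λ ε 0<ε → proj₁ (h ε 0<ε)) , weaken (λ ε 0<ε → proj₂ (h ε 0<ε))
    where
    weaken : ∀ {y} → (∀ ε → 0# < ε → 0# ≤ c + ε + y) → 0# ≤ c + y
    weaken {y} p = ≤-respʳ-≈ (solve 2 (λ c y → con +0 :- (:- (c :+ y)) := c :+ y) refl c y)
      (x≤y⇒0≤y-x (≤ε⇒≤0 λ ε 0<ε → ≤-by (solve 3 (λ c e y → e :- (:- (c :+ y)) := c :+ e :+ y) refl c ε y) (p ε 0<ε)))

  -- A Cauchy sequence approaches a cluster point `s` at the Cauchy rate itself: x N - s = -(x m - x
  -- N) + (x m - s), where m ≥ N can be taken with x m as near to `s` as desired. The sequence is
  -- bounded by the case N = 0, in which ½ ^ʳ 0 is `1#`.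
  geometric-cauchy : ∀ (x : ℕ → Carrier) c → (∀ N p → x (N ℕ.+ p) - x N ∈± c * ½ ^ʳ N) →
                     ∃[ s ] ∀ N → x N - s ∈± c * ½ ^ʳ N
  geometric-cauchy x c close = from-cluster-point (cluster-point x (c * 1# + b) bounded)
    where
    b = proj₁ (∃∈± (x 0))

    bounded : ∀ m → x m ∈± c * 1# + b
    bounded m = ∈±-resp-≈ (solve 2 (λ x y → y :- x :+ x := y) refl (x 0) (x m))
      (∈±-+ (close 0 m) (proj₂ (∃∈± (x 0))))

    from-cluster-point : ∃[ s ] (∀ ε → 0# < ε → ∀ N → ∃[ m ] N ℕ.≤ m × x m - s ∈± ε) →
                         ∃[ s ] ∀ N → x N - s ∈± c * ½ ^ʳ N
    from-cluster-point (s , near) = s , λ N → ∈±+ε⇒∈± λ ε 0<ε →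
      let (m , N≤m , x-s∈±ε) = near ε 0<ε N
      in ∈±-resp-≈ (solve 3 (λ a b s → :- (b :- a) :+ (b :- s) := a :- s) refl (x N) (x m) s)
           (∈±-+ (∈±-neg (tail N≤m)) x-s∈±ε)
      where
      tail : ∀ {N m} → N ℕ.≤ m → x m - x N ∈± c * ½ ^ʳ N
      tail {N} {m} N≤m = ≡.subst (λ m → x m - x N ∈± c * ½ ^ʳ N) (ℕ.m+[n∸m]≡n N≤m) (close N (m ℕ.∸ N))

  -- The root is the supremum of the numbers with square at most `x`: if its square fell short it
  -- could be raised, and if its square were too large a smaller number would already be an upper
  -- bound.
  square-root : ∀ x → 0# ≤ x → ∃[ y ] 0# ≤ y × y * y ≈ x
  square-root x 0≤x = s , 0≤s , antisym
    (dne λ s²≰x → too-big (≰⇒> s²≰x))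
    (dne λ x≰s² → too-small (≰⇒> x≰s²))
    where
    S : Pred Carrier 0ℓ
    S y = y * y ≤ x

    S-upper : IsUpperBound S (1# + x)
    S-upper y y²≤x = ≤-squares (0≤x+y 0≤1 0≤x) (≤-trans y²≤x
      (≤-by (solve 1 (λ x → (con (+ 1) :+ x) :* (con (+ 1) :+ x) :- x := con (+ 1) :+ (x :+ x :* x)) refl x)
        (0≤x+y 0≤1 (0≤x+y 0≤x (0≤x*x x)))))

    sup = supremum S (0# , ≤-respˡ-≈ (sym (zeroˡ 0#)) 0≤x) (1# + x , S-upper)
    s = proj₁ sup
    s-upper = proj₁ (proj₂ sup)
    s-least = proj₂ (proj₂ sup)

    0≤s : 0# ≤ s
    0≤s = s-upper 0# (≤-respˡ-≈ (sym (zeroˡ 0#)) 0≤x)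

    2s+1 : Carrier
    2s+1 = 1# + (s + s)

    0<2s+1 : 0# < 2s+1
    0<2s+1 = 0<x+y 0<1 (0≤x+y 0≤s 0≤s)

    too-small : ¬ s * s < x
    too-small s²<x = <⇒≱ 0<ε (≤-by (solve 2 (λ s e → con +0 :- e := s :- (s :+ e)) refl s ε)
        (x≤y⇒0≤y-x (s-upper (s + ε) [s+ε]²≤x)))
      where
      d c ε : Carrier
      d = x - s * s
      -- The summand `d` forces ε ≤ 1, hence ε² ≤ ε and (s + ε)² ≤ s² + (2s + 1)ε ≤ s² + d = x.
      c = d + 2s+1
      ε = d * c ⁻¹

      0<d : 0# < d
      0<d = x≤y⇒0≤y-x (<⇒≤ s²<x) , λ 0≈d → proj₂ s²<x
        (trans (trans (sym (+-identityˡ _)) (+-congʳ 0≈d)) (solve 2 (λ x y → x :- y :+ y := x) refl x (s * s)))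

      0<c : 0# < c
      0<c = 0<x+y 0<d (<⇒≤ 0<2s+1)

      0<ε : 0# < ε
      0<ε = 0<x*y 0<d (0<x⁻¹ 0<c)

      cε≈d : c * ε ≈ d
      cε≈d = trans (solve 3 (λ c d i → c :* (d :* i) := d :* (c :* i)) refl c d (c ⁻¹))
        (trans (*-congˡ (*-inverseʳ c (0<⇒≉0 0<c))) (*-identityʳ d))

      ε≤1 : ε ≤ 1#
      ε≤1 = *-cancelˡ-≤ 0<c (≤-respˡ-≈ (sym cε≈d)
        (≤-by (solve 2 (λ d t → (d :+ t) :* con (+ 1) :- d := t) refl d 2s+1) (<⇒≤ 0<2s+1)))

      [s+ε]²≤x : (s + ε) * (s + ε) ≤ x
      [s+ε]²≤x = ≤-by
        (trans (solve 3 (λ s e x → x :- (s :+ e) :* (s :+ e) := (x :- s :* s) :- (e :* e :+ e :* (s :+ s))) refl s ε x)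
          (trans (+-congʳ (sym cε≈d))
            (solve 3 (λ s e d → (d :+ (con (+ 1) :+ (s :+ s))) :* e :- (e :* e :+ e :* (s :+ s)) :=
              d :* e :+ e :* (con (+ 1) :- e)) refl s ε d)))
        (0≤x+y (*-nonNegative (<⇒≤ 0<d) (<⇒≤ 0<ε)) (*-nonNegative (<⇒≤ 0<ε) (x≤y⇒0≤y-x ε≤1)))

    too-big : ¬ x < s * s
    too-big x<s² = <⇒≱ 0<ε (≤-by (solve 2 (λ s e → con +0 :- e := s :- e :- s) refl s ε)
        (x≤y⇒0≤y-x (s-least (s - ε) upper)))
      where
      d ε : Carrier
      d = s * s - x
      ε = d * 2s+1 ⁻¹

      0<d : 0# < d
      0<d = x≤y⇒0≤y-x (<⇒≤ x<s²) , λ 0≈d → proj₂ x<s²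
        (trans (trans (sym (+-identityˡ _)) (+-congʳ 0≈d)) (solve 2 (λ x y → x :- y :+ y := x) refl (s * s) x))

      0<ε : 0# < ε
      0<ε = 0<x*y 0<d (0<x⁻¹ 0<2s+1)

      cε≈d : 2s+1 * ε ≈ d
      cε≈d = trans (solve 3 (λ c d i → c :* (d :* i) := d :* (c :* i)) refl 2s+1 d (2s+1 ⁻¹))
        (trans (*-congˡ (*-inverseʳ 2s+1 (0<⇒≉0 0<2s+1))) (*-identityʳ d))

      -- (2s + 1)(s − y) − d = (s − y) + (s − y)² + (x − y²)
      upper : IsUpperBound S (s - ε)
      upper y y²≤x = ≤-by (solve 3 (λ s e y → s :- e :- y := s :- y :- e) refl s ε y)
        (x≤y⇒0≤y-x (*-cancelˡ-≤ 0<2s+1 (≤-respˡ-≈ (sym cε≈d)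
          (≤-by (solve 3 (λ s y x → (con (+ 1) :+ (s :+ s)) :* (s :- y) :- (s :* s :- x) :=
                   (s :- y) :+ ((s :- y) :* (s :- y) :+ (x :- y :* y))) refl s y x)
            (0≤x+y (x≤y⇒0≤y-x (s-upper y y²≤x)) (0≤x+y (0≤x*x _) (x≤y⇒0≤y-x y²≤x)))))))

-- Complex arithmetic, square roots, and bounds on real and imaginary parts.

module ComplexNumbers (em : ExcludedMiddle 0ℓ) (F : CompleteOrderedField) where

  open UniformMixing em F hiding (_-_)
  open RealAnalysis em F hiding (zero)

  ℂ-commutativeRing : CommutativeRing 0ℓ 0ℓ
  ℂ-commutativeRing = record
    { Carrier = ℂ
    ; _≈_     = RawRing._≈_ ℂ-rawRing
    ; _+_     = RawRing._+_ ℂ-rawRing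
    ; _*_     = RawRing._*_ ℂ-rawRing
    ; -_      = RawRing.-_ ℂ-rawRing
    ; 0#      = RawRing.0# ℂ-rawRing
    ; 1#      = RawRing.1# ℂ-rawRing
    ; isCommutativeRing = record
      { isRing = record
        { +-isAbelianGroup = record
          { isGroup = record
            { isMonoid = record
              { isSemigroup = record
                { isMagma = record
                  { isEquivalence = record
                    { refl  = refl , refl
                    ; sym   = λ (p , q) → sym p , sym q
                    ; trans = λ (p , q) (r , s) → trans p r , trans q s
                    }
                  ; ∙-cong = λ (p , q) (r , s) → +-cong p r , +-cong q s
                  }
                ; assoc = λ x y z → +-assoc _ _ _ , +-assoc _ _ _
                }
              ; identity = (λ x → +-identityˡ _ , +-identityˡ _) ,
                           (λ x → +-identityʳ _ , +-identityʳ _)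
              }
            ; inverse = (λ x → -‿inverseˡ _ , -‿inverseˡ _) ,
                        (λ x → -‿inverseʳ _ , -‿inverseʳ _)
            ; ⁻¹-cong = λ (p , q) → -‿cong p , -‿cong q
            }
          ; comm = λ x y → +-comm _ _ , +-comm _ _
          }
        ; *-cong = λ (p , q) (r , s) →
            +-cong (*-cong p r) (-‿cong (*-cong q s)) ,
            +-cong (*-cong p s) (*-cong q r)
        ; *-assoc = λ x y z →
            solve 6 (λ a b c d e f → (a :* c :- b :* d) :* e :- (a :* d :+ b :* c) :* f
              := a :* (c :* e :- d :* f) :- b :* (c :* f :+ d :* e))
              refl (re x) (im x) (re y) (im y) (re z) (im z) ,
            solve 6 (λ a b c d e f → (a :* c :- b :* d) :* f :+ (a :* d :+ b :* c) :* e
              := a :* (c :* f :+ d :* e) :+ b :* (c :* e :- d :* f))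
              refl (re x) (im x) (re y) (im y) (re z) (im z)
        ; *-identity =
            (λ x →
              solve 2 (λ a b → con (+ 1) :* a :- con +0 :* b := a) refl (re x) (im x) ,
              solve 2 (λ a b → con (+ 1) :* b :+ con +0 :* a := b) refl (re x) (im x)) ,
            (λ x →
              solve 2 (λ a b → a :* con (+ 1) :- b :* con +0 := a) refl (re x) (im x) ,
              solve 2 (λ a b → a :* con +0 :+ b :* con (+ 1) := b) refl (re x) (im x))
        ; distrib =
            (λ x y z →
              solve 6 (λ a b c d e f → a :* (c :+ e) :- b :* (d :+ f)
                := a :* c :- b :* d :+ (a :* e :- b :* f))
                refl (re x) (im x) (re y) (im y) (re z) (im z) ,
              solve 6 (λ a b c d e f → a :* (d :+ f) :+ b :* (c :+ e)
                := a :* d :+ b :* c :+ (a :* f :+ b :* e))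
                refl (re x) (im x) (re y) (im y) (re z) (im z)) ,
            (λ x y z →
              solve 6 (λ a b c d e f → (c :+ e) :* a :- (d :+ f) :* b
                := c :* a :- d :* b :+ (e :* a :- f :* b))
                refl (re x) (im x) (re y) (im y) (re z) (im z) ,
              solve 6 (λ a b c d e f → (c :+ e) :* b :+ (d :+ f) :* a
                := c :* b :+ d :* a :+ (e :* b :+ f :* a))
                refl (re x) (im x) (re y) (im y) (re z) (im z))
        }
      ; *-comm = λ x y →
          solve 4 (λ a b c d → a :* c :- b :* d := c :* a :- d :* b)
            refl (re x) (im x) (re y) (im y) ,
          solve 4 (λ a b c d → a :* d :+ b :* c := c :* b :+ d :* a)
            refl (re x) (im x) (re y) (im y)
      }
    }

  private module ℂ′ = CommutativeRing ℂ-commutativeRing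
  open Algebra.Properties.Semiring.Sum ℂ′.semiring using () renaming (sum to ℂ-sum)

  choose-satisfies : ∀ {A : Set} {d : A} {P : Pred A 0ℓ} → ∃ P → P (choose d P)
  choose-satisfies {P = P} witness with em {P = ∃ P}
  ... | yes (_ , p) = p
  ... | no ¬∃       = contradiction witness ¬∃

  √-spec : ∀ {x} → 0# ≤ x → 0# ≤ √ x × √ x * √ x ≈ x
  √-spec {x} 0≤x = choose-satisfies (square-root x 0≤x)

  √-nonNegative : ∀ {x} → 0# ≤ x → 0# ≤ √ x
  √-nonNegative 0≤x = proj₁ (√-spec 0≤x)

  √-square : ∀ {x} → 0# ≤ x → √ x * √ x ≈ x
  √-square 0≤x = proj₂ (√-spec 0≤x)

  √x<ε⇒x≤ε² : ∀ {x ε} → 0# ≤ x → √ x < ε → x ≤ ε * ε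
  √x<ε⇒x≤ε² 0≤x (√x≤ε , _) = ≤-respˡ-≈ (√-square 0≤x)
    (*-mono-≤ (≤-trans (√-nonNegative 0≤x) √x≤ε) (√-nonNegative 0≤x) √x≤ε √x≤ε)

  x<ε²⇒√x<ε : ∀ {x ε} → 0# ≤ x → 0# ≤ ε → x < ε * ε → √ x < ε
  x<ε²⇒√x<ε 0≤x 0≤ε x<ε² = ≰⇒> λ ε≤√x → <⇒≱ x<ε²
    (≤-respʳ-≈ (√-square 0≤x) (*-mono-≤ (√-nonNegative 0≤x) 0≤ε ε≤√x ε≤√x))

  ∣z∣²-nonNegative : ∀ z → 0# ≤ ∣ z ∣²
  ∣z∣²-nonNegative z = 0≤x+y (0≤x*x (re z)) (0≤x*x (im z))

  -- With the factor 2, the bound on max (∣re z∣, ∣im z∣) becomes submultiplicative.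
  record Bounded (z : ℂ) (c : ℝ) : Set where
    constructor _,_
    field
      re-bound : re z + re z ∈± c
      im-bound : im z + im z ∈± c
  open Bounded public

  bounded-cong : ∀ {z w c} → z ℂ′.≈ w → Bounded z c → Bounded w c
  bounded-cong (p , q) (r , s) = ∈±-resp-≈ (+-cong p p) r , ∈±-resp-≈ (+-cong q q) s

  bounded-weaken : ∀ {z c d} → c ≤ d → Bounded z c → Bounded z d
  bounded-weaken c≤d (p , q) = ∈±-weaken c≤d p , ∈±-weaken c≤d q

  bounded-nonNegative : ∀ {z c} → Bounded z c → 0# ≤ c
  bounded-nonNegative (p , _) = ∈±⇒0≤ p

  bounded-fromℝ : ∀ {x} → 0# ≤ x → Bounded (fromℝ x) (x + x)
  bounded-fromℝ 0≤x = 0≤x∈±x (0≤x+y 0≤x 0≤x) ,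
    ∈±-resp-≈ (sym (+-identityˡ 0#)) (0∈± (0≤x+y 0≤x 0≤x))

  bounded-0 : ∀ {c} → 0# ≤ c → Bounded ℂ′.0# c
  bounded-0 0≤c = p , p
    where p = ∈±-resp-≈ (sym (+-identityˡ 0#)) (0∈± 0≤c)

  bounded-+ : ∀ {z w c d} → Bounded z c → Bounded w d → Bounded (z ℂ′.+ w) (c + d)
  bounded-+ {z} {w} (p , q) (r , s) =
    ∈±-resp-≈ (rearrange (re z) (re w)) (∈±-+ p r) , ∈±-resp-≈ (rearrange (im z) (im w)) (∈±-+ q s)
    where
    rearrange = solve 2 (λ a b → a :+ a :+ (b :+ b) := a :+ b :+ (a :+ b)) refl

  bounded-neg : ∀ {z c} → Bounded z c → Bounded (ℂ′.- z) c
  bounded-neg {z} (p , q) = ∈±-resp-≈ (rearrange (re z)) (∈±-neg p) , ∈±-resp-≈ (rearrange (im z)) (∈±-neg q)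
    where
    rearrange = solve 1 (λ a → :- (a :+ a) := (:- a) :+ (:- a)) refl

  bounded-conj : ∀ {z c} → Bounded z c → Bounded (conj z) c
  bounded-conj z≤c = re-bound z≤c , im-bound (bounded-neg z≤c)

  ∈±-halve : ∀ {x c} → x + x ∈± c + c → x ∈± c
  ∈±-halve {x} {c} (p , q) =
    halve-≤ (≤-respˡ-≈ (sym (+-identityˡ 0#)) (≤-respʳ-≈
      (solve 2 (λ x c → c :+ c :+ (x :+ x) := c :+ x :+ (c :+ x)) refl x c) p)) ,
    halve-≤ (≤-respˡ-≈ (sym (+-identityˡ 0#)) (≤-respʳ-≈
      (solve 2 (λ x c → c :+ c :- (x :+ x) := c :- x :+ (c :- x)) refl x c) q))

  -- Four times a part of the product is a sum of two products of doubled parts, hence within ±2cd;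
  -- halving leaves the doubled part within ±cd.
  bounded-* : ∀ {z w c d} → Bounded z c → Bounded w d → Bounded (z ℂ′.* w) (c * d)
  bounded-* {z} {w} (p , q) (r , s) =
    ∈±-halve (∈±-resp-≈
      (solve 4 (λ a b c d → (a :+ a) :* (c :+ c) :+ (:- ((b :+ b) :* (d :+ d)))
        := a :* c :- b :* d :+ (a :* c :- b :* d) :+ (a :* c :- b :* d :+ (a :* c :- b :* d)))
        refl (re z) (im z) (re w) (im w))
      (∈±-+ (∈±-* p r) (∈±-neg (∈±-* q s)))) ,
    ∈±-halve (∈±-resp-≈
      (solve 4 (λ a b c d → (a :+ a) :* (d :+ d) :+ (b :+ b) :* (c :+ c)
        := a :* d :+ b :* c :+ (a :* d :+ b :* c) :+ (a :* d :+ b :* c :+ (a :* d :+ b :* c)))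
        refl (re z) (im z) (re w) (im w))
      (∈±-+ (∈±-* p s) (∈±-* q r)))

  ∃bounded : ∀ z → ∃[ c ] Bounded z c
  ∃bounded z =
    let (c , p) = ∃∈± (re z + re z)
        (d , q) = ∃∈± (im z + im z)
    in c + d ,
       (∈±-resp-≈ (+-identityʳ _) (∈±-+ p (0∈± (∈±⇒0≤ q))) ,
        ∈±-resp-≈ (+-identityˡ _) (∈±-+ (0∈± (∈±⇒0≤ p)) q))

  bounded-sum : ∀ {n} {z : Fin n → ℂ} {c} → (∀ i → Bounded (z i) c) → Bounded (ℂ-sum z) (fromℕ n * c)
  bounded-sum {zero}  {c = c} _ = bounded-weaken (≤-reflexive (sym (zeroˡ c))) (bounded-0 ≤-refl)
  bounded-sum {suc n} {c = c} h = bounded-weaken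
    (≤-reflexive (solve 2 (λ n c → c :+ n :* c := (con (+ 1) :+ n) :* c) refl (fromℕ n) c))
    (bounded-+ (h zero) (bounded-sum (h ∘ suc)))

  ∣z∣²≤c²⇒bounded : ∀ {z c} → 0# ≤ c → ∣ z ∣² ≤ c * c → Bounded z (c + c)
  ∣z∣²≤c²⇒bounded {z} 0≤c ∣z∣²≤c² =
    ∈±-+ re∈ re∈ , ∈±-+ im∈ im∈
    where
    re∈ = x²≤c²⇒x∈±c 0≤c (≤-trans (≤-by
      (solve 2 (λ a b → a :+ b :- a := b) refl (re z * re z) (im z * im z)) (0≤x*x (im z))) ∣z∣²≤c²)
    im∈ = x²≤c²⇒x∈±c 0≤c (≤-trans (≤-by
      (solve 2 (λ a b → a :+ b :- b := a) refl (re z * re z) (im z * im z)) (0≤x*x (re z))) ∣z∣²≤c²)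

  bounded⇒2∣z∣²≤c² : ∀ {z c} → Bounded z c → ∣ z ∣² + ∣ z ∣² ≤ c * c
  bounded⇒2∣z∣²≤c² {z} {c} (p , q) = halve-≤ (≤-respˡ-≈
    (solve 2 (λ a b → (a :+ a) :* (a :+ a) :+ (b :+ b) :* (b :+ b)
      := a :* a :+ b :* b :+ (a :* a :+ b :* b) :+ (a :* a :+ b :* b :+ (a :* a :+ b :* b)))
      refl (re z) (im z))
    (+-mono-≤ (x∈±c⇒x²≤c² p) (x∈±c⇒x²≤c² q)))

-- Limits and subsequences of complex sequences.

module ComplexAnalysis (em : ExcludedMiddle 0ℓ) (F : CompleteOrderedField) where

  open UniformMixing em F hiding (_-_)
  module ℝ = RealAnalysis em F
  open ℝ using (½)
  open ComplexNumbers em F public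
  open CommutativeRing ℂ-commutativeRing public hiding (zero)
  open IntegerCoefficientSolver ℂ-commutativeRing public
  open Algebra.Properties.Semiring.Sum semiring public
    using (sum; ∑-comm; *-distribˡ-sum; *-distribʳ-sum)
  module ≈-Reasoning = Relation.Binary.Reasoning.Setoid setoid

  Null : (ℕ → ℂ) → Set
  Null z = ∀ ε → ℝ.0# ℝ.< ε → ∃[ N ] ∀ m → N ℕ.≤ m → Bounded (z m) ε

  infix 4 _⇝_
  -- Equivalent to `_⟶_`, but phrased through `Bounded`. As a record type it determines `z` and `l`,
  -- which unification could not recover from the difference `z m - l`.
  record _⇝_ (z : ℕ → ℂ) (l : ℂ) : Set where
    constructor converges
    field
      difference-null : Null (λ m → z m - l)
  open _⇝_ public

  x+x≤c⇒x<c : ∀ {x c} → ℝ.0# ℝ.< c → x ℝ.+ x ℝ.≤ c → x ℝ.< c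
  x+x≤c⇒x<c {x} {c} 0<c x+x≤c = ℝ.≰⇒> λ c≤x → ℝ.<⇒≱ 0<c
    (ℝ.≤-by (ℝ.solve 2 (λ x c → ℝ.con +0 ℝ.:- c ℝ.:= (c ℝ.:- (x ℝ.:+ x)) ℝ.:+ ((x ℝ.:- c) ℝ.:+ (x ℝ.:- c))) ℝ.refl x c)
      (ℝ.0≤x+y (ℝ.x≤y⇒0≤y-x x+x≤c) (ℝ.0≤x+y (ℝ.x≤y⇒0≤y-x c≤x) (ℝ.x≤y⇒0≤y-x c≤x))))

  -- `Bounded` is a weak inequality and `_⟶_` asks for a strict one. The doubling in `Bounded`
  -- provides the room: 2∣z∣² ≤ ε² and ε > 0 give ∣z∣² < ε².
  ⇝⇒⟶ : ∀ {z l} → z ⇝ l → z ⟶ l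
  ⇝⇒⟶ {z} {l} (converges z⇝l) ε 0<ε =
    let (N , close) = z⇝l ε 0<ε
    in N , λ m N≤m → x<ε²⇒√x<ε (∣z∣²-nonNegative (z m - l)) (ℝ.<⇒≤ 0<ε)
                       (x+x≤c⇒x<c (ℝ.0<x*y 0<ε 0<ε) (bounded⇒2∣z∣²≤c² (close m N≤m)))

  0<½ε : ∀ {ε} → ℝ.0# ℝ.< ε → ℝ.0# ℝ.< ½ ℝ.* ε
  0<½ε = ℝ.0<x*y ℝ.0<½

  ⟶⇒⇝ : ∀ {z l} → z ⟶ l → z ⇝ l
  ⟶⇒⇝ {z} {l} z⟶l = converges λ ε 0<ε →
    let (N , close) = z⟶l (½ ℝ.* ε) (0<½ε 0<ε)
    in N , λ m N≤m → bounded-weaken (ℝ.≤-reflexive (ℝ.½x+½x≈x ε))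
                       (∣z∣²≤c²⇒bounded (ℝ.<⇒≤ (0<½ε 0<ε)) (√x<ε⇒x≤ε² (∣z∣²-nonNegative (z m - l)) (close m N≤m)))

  null-cong : ∀ {z w} → (∀ m → z m ≈ w m) → Null z → Null w
  null-cong eq null ε 0<ε = let (N , small) = null ε 0<ε in N , λ m N≤m → bounded-cong (eq m) (small m N≤m)

  null-+ : ∀ {z w} → Null z → Null w → Null (λ m → z m + w m)
  null-+ z→0 w→0 ε 0<ε =
    let (N , z-small)  = z→0 (½ ℝ.* ε) (0<½ε 0<ε)
        (N′ , w-small) = w→0 (½ ℝ.* ε) (0<½ε 0<ε)
    in N ℕ.⊔ N′ , λ m N≤m → bounded-weaken (ℝ.≤-reflexive (ℝ.½x+½x≈x ε))
         (bounded-+ (z-small m (ℕ.≤-trans (ℕ.m≤m⊔n N N′) N≤m)) (w-small m (ℕ.≤-trans (ℕ.m≤n⊔m N N′) N≤m)))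

  null-geometric : ∀ {z} c → (∀ N → Bounded (z N) (c ℝ.* ½ ℝ.^ʳ N)) → Null z
  null-geometric {z} c bound ε 0<ε =
    -- Dividing by 1 + c instead of c covers the case c = 0.
    let (N , small) = ℝ.½^-small (ε ℝ.* (ℝ.1# ℝ.+ c) ℝ.⁻¹) (ℝ.0<x*y 0<ε (ℝ.0<x⁻¹ 0<1+c))
    in N , λ m N≤m → bounded-weaken (ℝ.≤-trans (ℝ.*-mono-≤ (ℝ.<⇒≤ 0<1+c) (ℝ.<⇒≤ (ℝ.0<½^ m)) c≤1+c (small m N≤m))
             (ℝ.≤-reflexive cancel)) (bound m)
    where
    0≤c : ℝ.0# ℝ.≤ c
    0≤c = ℝ.≤-respʳ-≈ (ℝ.*-identityʳ c) (bounded-nonNegative (bound 0))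

    c≤1+c : c ℝ.≤ ℝ.1# ℝ.+ c
    c≤1+c = ℝ.≤-by (ℝ.solve 2 (λ o c → o ℝ.:+ c ℝ.:- c ℝ.:= o) ℝ.refl ℝ.1# c) ℝ.0≤1

    0<1+c : ℝ.0# ℝ.< ℝ.1# ℝ.+ c
    0<1+c = ℝ.0<x+y ℝ.0<1 0≤c

    cancel : (ℝ.1# ℝ.+ c) ℝ.* (ε ℝ.* (ℝ.1# ℝ.+ c) ℝ.⁻¹) ℝ.≈ ε
    cancel = ℝ.trans (ℝ.solve 3 (λ c e i → c ℝ.:* (e ℝ.:* i) ℝ.:= e ℝ.:* (c ℝ.:* i)) ℝ.refl _ _ _)
      (ℝ.trans (ℝ.*-congˡ (ℝ.*-inverseʳ _ (ℝ.0<⇒≉0 0<1+c))) (ℝ.*-identityʳ ε))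

  null-* : ∀ {z w : ℕ → ℂ} → Null z → ∃[ c ] ∃[ N ] (∀ m → N ℕ.≤ m → Bounded (w m) c) → Null (λ m → z m * w m)
  null-* {z} {w} z→0 (c , N , w-bounded) ε 0<ε =
    let (N′ , z-small) = z→0 (ε ℝ.* (ℝ.1# ℝ.+ c) ℝ.⁻¹) (ℝ.0<x*y 0<ε (ℝ.0<x⁻¹ 0<1+c))
    in N ℕ.⊔ N′ , λ m N≤m → bounded-weaken
         (ℝ.≤-trans (ℝ.*-monoʳ-≤ (ℝ.<⇒≤ (ℝ.0<x*y 0<ε (ℝ.0<x⁻¹ 0<1+c))) c≤1+c) (ℝ.≤-reflexive cancel))
         (bounded-* (z-small m (ℕ.≤-trans (ℕ.m≤n⊔m N N′) N≤m)) (w-bounded m (ℕ.≤-trans (ℕ.m≤m⊔n N N′) N≤m)))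
    where
    c≤1+c : c ℝ.≤ ℝ.1# ℝ.+ c
    c≤1+c = ℝ.≤-by (ℝ.solve 2 (λ o c → o ℝ.:+ c ℝ.:- c ℝ.:= o) ℝ.refl ℝ.1# c) ℝ.0≤1

    0<1+c : ℝ.0# ℝ.< ℝ.1# ℝ.+ c
    0<1+c = ℝ.0<x+y ℝ.0<1 (bounded-nonNegative (w-bounded N ℕ.≤-refl))

    cancel : ε ℝ.* (ℝ.1# ℝ.+ c) ℝ.⁻¹ ℝ.* (ℝ.1# ℝ.+ c) ℝ.≈ ε
    cancel = ℝ.trans (ℝ.*-assoc _ _ _) (ℝ.trans (ℝ.*-congˡ (ℝ.*-inverseˡ (ℝ.0<⇒≉0 0<1+c))) (ℝ.*-identityʳ ε))

  ⇝-cong : ∀ {z w l k} → (∀ m → z m ≈ w m) → l ≈ k → z ⇝ l → w ⇝ k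
  ⇝-cong z≈w l≈k (converges z⇝l) = converges (null-cong (λ m → +-cong (z≈w m) (-‿cong l≈k)) z⇝l)

  ⇝-const : ∀ z → (λ _ → z) ⇝ z
  ⇝-const z = converges λ ε 0<ε → 0 , λ _ _ → bounded-cong (sym (-‿inverseʳ z)) (bounded-0 (ℝ.<⇒≤ 0<ε))

  ⇝-+ : ∀ {z w l k} → z ⇝ l → w ⇝ k → (λ m → z m + w m) ⇝ l + k
  ⇝-+ {z} {w} {l} {k} (converges z⇝l) (converges w⇝k) = converges (null-cong
    (λ m → solve 4 (λ z w l k → (z :- l) :+ (w :- k) := z :+ w :- (l :+ k)) refl (z m) (w m) l k)
    (null-+ z⇝l w⇝k))

  ⇝-conj : ∀ {z l} → z ⇝ l → (λ m → conj (z m)) ⇝ conj l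
  ⇝-conj {z} {l} (converges z⇝l) = converges λ ε 0<ε →
    let (N , close) = z⇝l ε 0<ε
    in N , λ m N≤m → bounded-cong (ℝ.refl , ℝ.solve 2 (λ z l → ℝ.:- (z ℝ.:- l) ℝ.:= (ℝ.:- z) ℝ.:- (ℝ.:- l)) ℝ.refl (im (z m)) (im l))
         (bounded-conj (close m N≤m))

  ⇝-bounded : ∀ {z l} → z ⇝ l → ∃[ c ] ∃[ N ] (∀ m → N ℕ.≤ m → Bounded (z m) c)
  ⇝-bounded {z} {l} (converges z⇝l) =
    let (c , l-bounded) = ∃bounded l
        (N , close)     = z⇝l ℝ.1# ℝ.0<1
    in ℝ.1# ℝ.+ c , N , λ m N≤m → bounded-cong
         (solve 2 (λ z l → z :- l :+ l := z) refl (z m) l) (bounded-+ (close m N≤m) l-bounded)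

  ⇝-* : ∀ {z w l k} → z ⇝ l → w ⇝ k → (λ m → z m * w m) ⇝ l * k
  ⇝-* {z} {w} {l} {k} z⇝l w⇝k = converges (null-cong
    (λ m → solve 4 (λ z w l k → (z :- l) :* w :+ (w :- k) :* l := z :* w :- l :* k) refl (z m) (w m) l k)
    (null-+ (null-* (difference-null z⇝l) (⇝-bounded w⇝k))
      (null-* (difference-null w⇝k) (let (c , l-bounded) = ∃bounded l in c , 0 , λ _ _ → l-bounded))))

  ⇝-sum : ∀ {n} {z : Fin n → ℕ → ℂ} {l} → (∀ i → z i ⇝ l i) → (λ m → sum (λ i → z i m)) ⇝ sum l
  ⇝-sum {zero}  _ = ⇝-const 0#
  ⇝-sum {suc n} h = ⇝-+ (h zero) (⇝-sum (h ∘ suc))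

  bounded-ε⇒≈0 : ∀ {z} → (∀ ε → ℝ.0# ℝ.< ε → Bounded z ε) → z ≈ 0#
  bounded-ε⇒≈0 {z} small = halve (λ ε 0<ε → re-bound (small ε 0<ε)) , halve (λ ε 0<ε → im-bound (small ε 0<ε))
    where
    halve : ∀ {x} → (∀ ε → ℝ.0# ℝ.< ε → x ℝ.+ x ℝ.∈± ε) → x ℝ.≈ ℝ.0#
    halve small = ℝ.∈±ε⇒≈0 λ ε 0<ε → ∈±-halve (small (ε ℝ.+ ε) (ℝ.0<x+y 0<ε (ℝ.<⇒≤ 0<ε)))

  ⇝-unique : ∀ {z l k} → z ⇝ l → z ⇝ k → l ≈ k
  ⇝-unique {z} {l} {k} (converges z⇝l) (converges z⇝k) = begin
    l             ≈⟨ solve 2 (λ l k → l := l :- k :+ k) refl l k ⟩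
    l - k + k     ≈⟨ +-congʳ (bounded-ε⇒≈0 close) ⟩
    0# + k        ≈⟨ +-identityˡ k ⟩
    k             ∎
    where
    open ≈-Reasoning
    close : ∀ ε → ℝ.0# ℝ.< ε → Bounded (l - k) ε
    close ε 0<ε =
      let (N , l-close)  = z⇝l (½ ℝ.* ε) (0<½ε 0<ε)
          (N′ , k-close) = z⇝k (½ ℝ.* ε) (0<½ε 0<ε)
          m = N ℕ.⊔ N′
      in bounded-weaken (ℝ.≤-reflexive (ℝ.½x+½x≈x ε)) (bounded-cong
           (solve 3 (λ z l k → :- (z :- l) :+ (z :- k) := l :- k) refl (z m) l k)
           (bounded-+ (bounded-neg (l-close m (ℕ.m≤m⊔n N N′))) (k-close m (ℕ.m≤n⊔m N N′))))

  lim-⇝ : ∀ {z l} → z ⇝ l → z ⇝ lim z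
  lim-⇝ {l = l} z⇝l = ⟶⇒⇝ (choose-satisfies (l , ⇝⇒⟶ z⇝l))

  -- For composing limits, m ≤ φ m serves as well as strict monotonicity.
  Extraction : (ℕ → ℕ) → Set
  Extraction φ = ∀ m → m ℕ.≤ φ m

  ⇝-extract : ∀ {z l φ} → Extraction φ → z ⇝ l → z ∘ φ ⇝ l
  ⇝-extract {φ = φ} m≤φm (converges z⇝l) = converges λ ε 0<ε →
    let (N , close) = z⇝l ε 0<ε in N , λ m N≤m → close (φ m) (ℕ.≤-trans N≤m (m≤φm m))

  -- `Bounded` controls doubled parts, so the real lemmas produce limits of the doubled real and
  -- imaginary parts; this turns them into the complex limit.
  halved : ℝ → ℝ → ℂ
  halved x y = ½ ℝ.* x +ⅈ ½ ℝ.* y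

  bounded-halved : ∀ {z x y c} → re z ℝ.+ re z ℝ.- x ℝ.∈± c → im z ℝ.+ im z ℝ.- y ℝ.∈± c → Bounded (z - halved x y) c
  bounded-halved {z} {x} {y} p q = ℝ.∈±-resp-≈ (double (re z) x) p , ℝ.∈±-resp-≈ (double (im z) y) q
    where
    double : ∀ a x → a ℝ.+ a ℝ.- x ℝ.≈ a ℝ.- ½ ℝ.* x ℝ.+ (a ℝ.- ½ ℝ.* x)
    double a x = ℝ.trans (ℝ.+-congˡ (ℝ.-‿cong (ℝ.sym (ℝ.½x+½x≈x x))))
      (ℝ.solve 2 (λ a h → a ℝ.:+ a ℝ.:- (h ℝ.:+ h) ℝ.:= a ℝ.:- h ℝ.:+ (a ℝ.:- h)) ℝ.refl a (½ ℝ.* x))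

  geometric-cauchy : ∀ {z : ℕ → ℂ} c → (∀ N p → Bounded (z (N ℕ.+ p) - z N) (c ℝ.* ½ ℝ.^ʳ N)) → ∃[ l ] z ⇝ l
  geometric-cauchy {z} c close =
    let (x , p) = ℝ.geometric-cauchy (λ m → re (z m) ℝ.+ re (z m)) c
                    (λ N k → ℝ.∈±-resp-≈ (double (re (z (N ℕ.+ k))) (re (z N))) (re-bound (close N k)))
        (y , q) = ℝ.geometric-cauchy (λ m → im (z m) ℝ.+ im (z m)) c
                    (λ N k → ℝ.∈±-resp-≈ (double (im (z (N ℕ.+ k))) (im (z N))) (im-bound (close N k)))
    in halved x y , converges (null-geometric c (λ N → bounded-halved {z N} (p N) (q N)))
    where
    double = ℝ.solve 2 (λ a b → a ℝ.:- b ℝ.:+ (a ℝ.:- b) ℝ.:= a ℝ.:+ a ℝ.:- (b ℝ.:+ b)) ℝ.refl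

  bolzano-weierstrass : ∀ {z : ℕ → ℂ} {c} → (∀ m → Bounded (z m) c) →
                        ∃[ φ ] Extraction φ × ∃[ l ] z ∘ φ ⇝ l
  bolzano-weierstrass {z} {c} bounded =
    φ ∘ ψ , (λ m → ℕ.≤-trans (m≤ψm m) (m≤φm (ψ m))) , halved x y , converges (null-geometric ℝ.1# λ m →
      bounded-weaken (ℝ.≤-reflexive (ℝ.sym (ℝ.*-identityˡ _)))
        (bounded-halved {z (φ (ψ m))} (ℝ.∈±-weaken (ℝ.½^-antimono-≤ (ℕ.≤⇒≤′ (m≤ψm m))) (re-close (ψ m))) (im-close m)))
    where
    extract : ∀ (x : ℕ → ℝ) → (∀ m → x m ℝ.∈± c) →
              ∃[ s ] ∃[ φ ] Extraction φ × (∀ m → x (φ m) ℝ.- s ℝ.∈± ½ ℝ.^ʳ m)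
    extract x x-bounded =
      let (s , near) = ℝ.cluster-point x c x-bounded
          -- The same m serves as tolerance exponent and as lower bound for the index, so that
          -- convergence and `Extraction` come out together.
          choice m = near (½ ℝ.^ʳ m) (ℝ.0<½^ m) m
      in s , (λ m → proj₁ (choice m)) , (λ m → proj₁ (proj₂ (choice m))) , λ m → proj₂ (proj₂ (choice m))

    re-part = extract (λ m → re (z m) ℝ.+ re (z m)) (λ m → re-bound (bounded m))
    x        = proj₁ re-part
    φ        = proj₁ (proj₂ re-part)
    m≤φm     = proj₁ (proj₂ (proj₂ re-part))
    re-close = proj₂ (proj₂ (proj₂ re-part))

    im-part = extract (λ m → im (z (φ m)) ℝ.+ im (z (φ m))) (λ m → im-bound (bounded (φ m)))
    y        = proj₁ im-part
    ψ        = proj₁ (proj₂ im-part)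
    m≤ψm     = proj₁ (proj₂ (proj₂ im-part))
    im-close = proj₂ (proj₂ (proj₂ im-part))

  -- The indices are treated one after another, and stability carries what has been achieved along
  -- later extractions. Because it starts from an arbitrary `φ`, the lemma can supply its own
  -- extraction hypothesis: for matrices it is applied to the columns within a row and then to the
  -- rows.
  extract-finite : ∀ {k} (P : Fin k → (ℕ → ℕ) → Set) →
                   (∀ i {φ ψ} → Extraction ψ → P i φ → P i (φ ∘ ψ)) →
                   (∀ i φ → ∃[ ψ ] Extraction ψ × P i (φ ∘ ψ)) →
                   ∀ φ → ∃[ ψ ] Extraction ψ × (∀ i → P i (φ ∘ ψ))
  extract-finite {zero}  P stable extract φ = (λ m → m) , (λ m → ℕ.≤-refl) , λ ()
  extract-finite {suc k} P stable extract φ =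
    let (ψ , m≤ψm , Pψ) = extract-finite (P ∘ suc) (λ i → stable (suc i)) (λ i → extract (suc i)) φ
        (χ , m≤χm , Pχ) = extract zero (φ ∘ ψ)
    in ψ ∘ χ , (λ m → ℕ.≤-trans (m≤χm m) (m≤ψm (χ m))) ,
       λ { zero → Pχ ; (suc i) → stable (suc i) m≤χm (Pψ i) }

  bolzano-weierstrass-matrix : ∀ {n} {Z : ℕ → Matrix ℂ n} {c} → (∀ m u v → Bounded (Z m u v) c) →
                               ∃[ φ ] ∃[ W ] Extraction φ × (∀ u v → (λ m → Z (φ m) u v) ⇝ W u v)
  bolzano-weierstrass-matrix {n} {Z} bounded =
    let (φ , m≤φm , convergent) = extract-finite (λ u φ → ∀ v → Converges u v φ)
          (λ u m≤ψm h v → stable u v m≤ψm (h v))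
          (λ u → extract-finite (Converges u) (stable u)
            (λ v φ → bolzano-weierstrass (λ m → bounded (φ m) u v)))
          (λ m → m)
    in φ , (λ u v → proj₁ (convergent u v)) , m≤φm , λ u v → proj₂ (convergent u v)
    where
    Converges : Fin n → Fin n → (ℕ → ℕ) → Set
    Converges u v φ = ∃[ l ] (λ m → Z (φ m) u v) ⇝ l

    stable : ∀ u v {φ ψ} → Extraction ψ → Converges u v φ → Converges u v (φ ∘ ψ)
    stable u v m≤ψm (l , h) = l , ⇝-extract m≤ψm h

-- Finite double sums and the Cauchy product.

module DoubleSums (R : CommutativeRing 0ℓ 0ℓ) where

  open CommutativeRing R hiding (zero)
  open IntegerCoefficientSolver R
  open Algebra.Properties.Semiring.Sum semiring using (sum; sum-cong-≋)
  open Relation.Binary.Reasoning.Setoid setoid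

  partialSum : (ℕ → Carrier) → ℕ → Carrier
  partialSum f N = sum {N} (λ k → f (toℕ k))

  partialSum-cong : ∀ {f g} → (∀ k → f k ≈ g k) → ∀ N → partialSum f N ≈ partialSum g N
  partialSum-cong f≈g N = sum-cong-≋ {N} (λ k → f≈g (toℕ k))

  partialSum-last : ∀ f N → partialSum f (suc N) ≈ partialSum f N + f N
  partialSum-last f zero    = +-comm _ _
  partialSum-last f (suc N) = trans (+-congˡ (partialSum-last (f ∘ suc) N)) (sym (+-assoc _ _ _))

  rectangle : ℕ → ℕ → (ℕ → ℕ → Carrier) → Carrier
  rectangle P Q a = partialSum (λ j → partialSum (a j) Q) P

  -- The sum over all pairs with j + k < N, taken row by row.
  triangle : ℕ → (ℕ → ℕ → Carrier) → Carrier
  triangle zero    a = 0#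
  triangle (suc N) a = partialSum (a 0) (suc N) + triangle N (a ∘ suc)

  -- The sum over all pairs with j + k = N: the coefficient of degree N in a Cauchy product.
  diagonal : ℕ → (ℕ → ℕ → Carrier) → Carrier
  diagonal zero    a = a 0 0
  diagonal (suc N) a = a 0 (suc N) + diagonal N (a ∘ suc)

  triangle-suc : ∀ N a → triangle (suc N) a ≈ triangle N a + diagonal N a
  triangle-suc zero a = solve 1 (λ x → x :+ con +0 :+ con +0 := con +0 :+ x) refl (a 0 0)
  triangle-suc (suc N) a = begin
    partialSum (a 0) (suc (suc N)) + triangle (suc N) (a ∘ suc)
      ≈⟨ +-cong (partialSum-last (a 0) (suc N)) (triangle-suc N (a ∘ suc)) ⟩
    partialSum (a 0) (suc N) + a 0 (suc N) + (triangle N (a ∘ suc) + diagonal N (a ∘ suc))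
      ≈⟨ solve 4 (λ s x t d → s :+ x :+ (t :+ d) := s :+ t :+ (x :+ d)) refl _ _ _ _ ⟩
    triangle (suc N) a + diagonal (suc N) a
      ∎

  triangle-collapse : ∀ a → (∀ N → diagonal (suc N) a ≈ 0#) → ∀ N → triangle (suc N) a ≈ a 0 0
  triangle-collapse a vanish zero    = trans (triangle-suc 0 a) (+-identityˡ _)
  triangle-collapse a vanish (suc N) =
    trans (triangle-suc (suc N) a) (trans (+-cong (triangle-collapse a vanish N) (vanish N)) (+-identityʳ _))

  diagonal-cong : ∀ {a b} → (∀ j k → a j k ≈ b j k) → ∀ N → diagonal N a ≈ diagonal N b
  diagonal-cong a≈b zero    = a≈b 0 0
  diagonal-cong a≈b (suc N) = +-cong (a≈b 0 (suc N)) (diagonal-cong (λ j → a≈b (suc j)) N)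

  diagonal-+ : ∀ a b N → diagonal N (λ j k → a j k + b j k) ≈ diagonal N a + diagonal N b
  diagonal-+ a b zero    = refl
  diagonal-+ a b (suc N) = trans (+-congˡ (diagonal-+ (a ∘ suc) (b ∘ suc) N))
    (solve 4 (λ a b c d → a :+ b :+ (c :+ d) := a :+ c :+ (b :+ d)) refl _ _ _ _)

  diagonal-neg : ∀ a N → diagonal N (λ j k → - a j k) ≈ - diagonal N a
  diagonal-neg a zero    = refl
  diagonal-neg a (suc N) = trans (+-congˡ (diagonal-neg (a ∘ suc) N))
    (solve 2 (λ x y → (:- x) :- y := :- (x :+ y)) refl _ _)

  -- A factor that depends on j + k alone is constant along a diagonal. It serves twice: for the
  -- degree in the derivative argument and for the entries of B ^ (j + k).
  diagonal-graded : ∀ (φ : ℕ → Carrier) a N → diagonal N (λ j k → φ (j ℕ.+ k) * a j k) ≈ φ N * diagonal N a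
  diagonal-graded φ a zero    = refl
  diagonal-graded φ a (suc N) = trans (+-congˡ (diagonal-graded (φ ∘ suc) (a ∘ suc) N)) (sym (distribˡ _ _ _))

  diagonal-last : ∀ a N → diagonal (suc N) a ≈ a (suc N) 0 + diagonal N (λ j k → a j (suc k))
  diagonal-last a zero    = +-comm _ _
  diagonal-last a (suc N) = trans (+-congˡ (diagonal-last (a ∘ suc) N))
    (solve 3 (λ x y z → x :+ (y :+ z) := y :+ (x :+ z)) refl _ _ _)


  -- Multiplying the coefficient of degree N in exp x · exp (-x) by N differentiates the product,
  -- and the derivative exp x · exp (-x) - exp x · exp (-x) vanishes.
  diagonal-derivative : (ν α β : ℕ → Carrier) → ν 0 ≈ 0# → (∀ j k → ν (j ℕ.+ k) ≈ ν j + ν k) →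
                        (∀ k → ν (suc k) * α (suc k) ≈ α k) → (∀ k → ν (suc k) * β (suc k) ≈ - β k) →
                        ∀ N → ν (suc N) * diagonal (suc N) (λ j k → α j * β k) ≈ 0#
  diagonal-derivative ν α β ν-zero ν-+ α-suc β-suc N = begin
    ν (suc N) * diagonal (suc N) e
      ≈⟨ diagonal-graded ν e (suc N) ⟨
    diagonal (suc N) (λ j k → ν (j ℕ.+ k) * e j k)
      -- Leibniz rule: the degree splits as j + k. The part with j lowers the index of `α`, the part
      -- with k lowers that of `β` and changes the sign.
      ≈⟨ diagonal-cong (λ j k → trans (*-congʳ (ν-+ j k)) (distribʳ (e j k) (ν j) (ν k))) (suc N) ⟩
    diagonal (suc N) (λ j k → ν j * e j k + ν k * e j k)
      ≈⟨ diagonal-+ (λ j k → ν j * e j k) (λ j k → ν k * e j k) (suc N) ⟩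
    diagonal (suc N) (λ j k → ν j * e j k) + diagonal (suc N) (λ j k → ν k * e j k)
      ≈⟨ +-cong left right ⟩
    diagonal N e - diagonal N e
      ≈⟨ -‿inverseʳ _ ⟩
    0#
      ∎
    where
    e : ℕ → ℕ → Carrier
    e j k = α j * β k

    left : diagonal (suc N) (λ j k → ν j * e j k) ≈ diagonal N e
    left = trans
      (+-cong (trans (*-congʳ ν-zero) (zeroˡ _))
        (diagonal-cong (λ j k → trans (sym (*-assoc _ _ _)) (*-congʳ (α-suc j))) N))
      (+-identityˡ _)

    right : diagonal (suc N) (λ j k → ν k * e j k) ≈ - diagonal N e
    right = begin
      diagonal (suc N) (λ j k → ν k * e j k)
        ≈⟨ diagonal-last (λ j k → ν k * e j k) N ⟩
      ν 0 * e (suc N) 0 + diagonal N (λ j k → ν (suc k) * e j (suc k))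
        ≈⟨ trans (+-congʳ (trans (*-congʳ ν-zero) (zeroˡ _))) (+-identityˡ _) ⟩
      diagonal N (λ j k → ν (suc k) * (α j * β (suc k)))
        ≈⟨ diagonal-cong (λ j k → trans (solve 3 (λ n a b → n :* (a :* b) := a :* (n :* b)) refl _ _ _)
             (trans (*-congˡ (β-suc k)) (solve 2 (λ a b → a :* (:- b) := :- (a :* b)) refl _ _))) N ⟩
      diagonal N (λ j k → - e j k)
        ≈⟨ diagonal-neg e N ⟩
      - diagonal N e
        ∎

-- Matrix algebra over a commutative ring.

module IdentityMatrix (R : CommutativeRing 0ℓ 0ℓ) where

  open CommutativeRing R hiding (zero)
  open Algebra.Properties.Semiring.Sum semiring using (sum; sum-cong-≋; sum-replicate-zero)
  open Relation.Binary.Reasoning.Setoid setoid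

  ∑-cong : ∀ n {f g : Fin n → Carrier} → (∀ i → f i ≈ g i) → sum f ≈ sum g
  ∑-cong n = sum-cong-≋ {n}

  -- Over the complex numbers this unfolds to the identity matrix of the Hadamard condition; over
  -- the reals it yields the row sums of `D`.
  I : ∀ {n} → Fin n → Fin n → Carrier
  I u v = if does (u ≟ v) then 1# else 0#

  sum-const-zero : ∀ {n} {f : Fin n → Carrier} → (∀ i → f i ≈ 0#) → sum f ≈ 0#
  sum-const-zero {n} f≈0 = trans (∑-cong n f≈0) (sum-replicate-zero n)

  sum-I-* : ∀ {n} (u : Fin n) x → sum (λ w → I u w * x w) ≈ x u
  sum-I-* {suc n} zero x = begin
    1# * x zero + sum (λ w → 0# * x (suc w))     ≈⟨ +-cong (*-identityˡ _) (sum-const-zero {n} (λ w → zeroˡ _)) ⟩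
    x zero + 0#                                  ≈⟨ +-identityʳ _ ⟩
    x zero                                       ∎
  sum-I-* {suc n} (suc u) x = begin
    0# * x zero + sum (λ w → I u w * x (suc w))  ≈⟨ +-cong (zeroˡ _) (sum-I-* u (λ w → x (suc w))) ⟩
    0# + x (suc u)                               ≈⟨ +-identityˡ _ ⟩
    x (suc u)                                    ∎

  I-sym : ∀ {n} (u v : Fin n) → I u v ≈ I v u
  I-sym zero    zero    = refl
  I-sym zero    (suc v) = refl
  I-sym (suc u) zero    = refl
  I-sym (suc u) (suc v) = I-sym u v

  sum-*-I : ∀ {n} (v : Fin n) x → sum (λ w → x w * I w v) ≈ x v
  sum-*-I {n} v x = trans (∑-cong n (λ w → trans (*-comm _ _) (*-congʳ (I-sym w v)))) (sum-I-* v x)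

module Matrices (R : CommutativeRing 0ℓ 0ℓ) (n : ℕ) where

  open CommutativeRing R hiding (zero)
  open IntegerCoefficientSolver R
  open DoubleSums R
  open IdentityMatrix R public
  open Algebra.Properties.Semiring.Sum semiring using (sum; *-distribˡ-sum; *-distribʳ-sum; ∑-comm)
  open Relation.Binary.Reasoning.Setoid setoid

  SquareMatrix : Set
  SquareMatrix = Fin n → Fin n → Carrier

  infix 4 _≋_
  _≋_ : SquareMatrix → SquareMatrix → Set
  B ≋ C = ∀ u v → B u v ≈ C u v

  infixl 7 _⊗_
  _⊗_ : SquareMatrix → SquareMatrix → SquareMatrix
  (B ⊗ C) u v = sum (λ w → B u w * C w v)

  infixr 8 _^_
  _^_ : SquareMatrix → ℕ → SquareMatrix
  B ^ zero  = I
  B ^ suc k = B ⊗ B ^ k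

  ⊗-identityˡ : (B : SquareMatrix) → I ⊗ B ≋ B
  ⊗-identityˡ B u v = sum-I-* u (λ w → B w v)

  ⊗-identityʳ : (B : SquareMatrix) → B ⊗ I ≋ B
  ⊗-identityʳ B u v = sum-*-I v (B u)

  ⊗-congˡ : (B : SquareMatrix) {C D : SquareMatrix} → C ≋ D → B ⊗ C ≋ B ⊗ D
  ⊗-congˡ B C≋D u v = ∑-cong n (λ w → *-congˡ (C≋D w v))

  ⊗-congʳ : (D : SquareMatrix) {B C : SquareMatrix} → B ≋ C → B ⊗ D ≋ C ⊗ D
  ⊗-congʳ D B≋C u v = ∑-cong n (λ w → *-congʳ (B≋C u w))

  ⊗-assoc : (B C D : SquareMatrix) → (B ⊗ C) ⊗ D ≋ B ⊗ (C ⊗ D)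
  ⊗-assoc B C D u v = begin
    sum (λ w → sum (λ x → B u x * C x w) * D w v)      ≈⟨ ∑-cong n (λ w → *-distribʳ-sum {n} (D w v) (λ x → B u x * C x w)) ⟩
    sum (λ w → sum (λ x → B u x * C x w * D w v))      ≈⟨ ∑-comm {n} {n} (λ w x → B u x * C x w * D w v) ⟩
    sum (λ x → sum (λ w → B u x * C x w * D w v))      ≈⟨ ∑-cong n (λ x → ∑-cong n (λ w → *-assoc _ _ _)) ⟩
    sum (λ x → sum (λ w → B u x * (C x w * D w v)))    ≈⟨ ∑-cong n (λ x → *-distribˡ-sum {n} (B u x) (λ w → C x w * D w v)) ⟨
    sum (λ x → B u x * sum (λ w → C x w * D w v))      ∎

  ⊗-^-comm : (C B : SquareMatrix) → C ⊗ B ≋ B ⊗ C → ∀ k → C ⊗ B ^ k ≋ B ^ k ⊗ C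
  ⊗-^-comm C B comm zero    u v = trans (⊗-identityʳ C u v) (sym (⊗-identityˡ C u v))
  ⊗-^-comm C B comm (suc k) u v = begin
    (C ⊗ (B ⊗ B ^ k)) u v    ≈⟨ ⊗-assoc C B (B ^ k) u v ⟨
    ((C ⊗ B) ⊗ B ^ k) u v    ≈⟨ ⊗-congʳ (B ^ k) comm u v ⟩
    ((B ⊗ C) ⊗ B ^ k) u v    ≈⟨ ⊗-assoc B C (B ^ k) u v ⟩
    (B ⊗ (C ⊗ B ^ k)) u v    ≈⟨ ⊗-congˡ B (⊗-^-comm C B comm k) u v ⟩
    (B ⊗ (B ^ k ⊗ C)) u v    ≈⟨ ⊗-assoc B (B ^ k) C u v ⟨
    ((B ⊗ B ^ k) ⊗ C) u v    ∎

  ^-+ : (B : SquareMatrix) → ∀ j k → B ^ (j ℕ.+ k) ≋ B ^ j ⊗ B ^ k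
  ^-+ B zero    k u v = sym (⊗-identityˡ (B ^ k) u v)
  ^-+ B (suc j) k u v = trans (⊗-congˡ B (^-+ B j k) u v) (sym (⊗-assoc B (B ^ j) (B ^ k) u v))

  -- Transposition reverses the product `B ⊗ B ^ k`, and `B` commutes with its own powers.
  ^-symmetric : (B : SquareMatrix) → (∀ u v → B u v ≈ B v u) → ∀ k u v → (B ^ k) u v ≈ (B ^ k) v u
  ^-symmetric B B-sym zero    u v = I-sym u v
  ^-symmetric B B-sym (suc k) u v = begin
    sum (λ w → B u w * (B ^ k) w v)    ≈⟨ ∑-cong n (λ w → trans (*-cong (B-sym u w) (^-symmetric B B-sym k w v)) (*-comm _ _)) ⟩
    (B ^ k ⊗ B) v u                    ≈⟨ ⊗-^-comm B B (λ _ _ → refl) k v u ⟨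
    (B ⊗ B ^ k) v u                    ∎

  -- The coefficients are left open so that the exponential series and its conjugate, with
  -- alternating signs, are both instances.
  powerSum : (ℕ → Carrier) → SquareMatrix → ℕ → SquareMatrix
  powerSum c B N u v = partialSum (λ k → c k * (B ^ k) u v) N

  ⊗-powerSum-comm : ∀ c (C B : SquareMatrix) → C ⊗ B ≋ B ⊗ C → ∀ N → C ⊗ powerSum c B N ≋ powerSum c B N ⊗ C
  ⊗-powerSum-comm c C B comm N u v = begin
    sum (λ w → C u w * sum {N} (λ k → c (toℕ k) * (B ^ toℕ k) w v))
      ≈⟨ ∑-cong n (λ w → *-distribˡ-sum {N} (C u w) (λ k → c (toℕ k) * (B ^ toℕ k) w v)) ⟩
    sum (λ w → sum {N} (λ k → C u w * (c (toℕ k) * (B ^ toℕ k) w v)))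
      ≈⟨ ∑-comm {n} {N} (λ w k → C u w * (c (toℕ k) * (B ^ toℕ k) w v)) ⟩
    sum {N} (λ k → sum (λ w → C u w * (c (toℕ k) * (B ^ toℕ k) w v)))
      ≈⟨ ∑-cong N (λ k → term (toℕ k)) ⟩
    sum {N} (λ k → sum (λ w → c (toℕ k) * (B ^ toℕ k) u w * C w v))
      ≈⟨ ∑-comm {n} {N} (λ w k → c (toℕ k) * (B ^ toℕ k) u w * C w v) ⟨
    sum (λ w → sum {N} (λ k → c (toℕ k) * (B ^ toℕ k) u w * C w v))
      ≈⟨ ∑-cong n (λ w → *-distribʳ-sum {N} (C w v) (λ k → c (toℕ k) * (B ^ toℕ k) u w)) ⟨
    sum (λ w → sum {N} (λ k → c (toℕ k) * (B ^ toℕ k) u w) * C w v)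
      ∎
    where
    term : ∀ k → sum (λ w → C u w * (c k * (B ^ k) w v)) ≈ sum (λ w → c k * (B ^ k) u w * C w v)
    term k = begin
      sum (λ w → C u w * (c k * (B ^ k) w v))    ≈⟨ ∑-cong n (λ w → solve 3 (λ a b d → a :* (b :* d) := b :* (a :* d)) refl _ _ _) ⟩
      sum (λ w → c k * (C u w * (B ^ k) w v))    ≈⟨ *-distribˡ-sum {n} (c k) (λ w → C u w * (B ^ k) w v) ⟨
      c k * (C ⊗ B ^ k) u v                      ≈⟨ *-congˡ (⊗-^-comm C B comm k u v) ⟩
      c k * (B ^ k ⊗ C) u v                      ≈⟨ *-distribˡ-sum {n} (c k) (λ w → (B ^ k) u w * C w v) ⟩
      sum (λ w → c k * ((B ^ k) u w * C w v))    ≈⟨ ∑-cong n (λ w → *-assoc _ _ _) ⟨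
      sum (λ w → c k * (B ^ k) u w * C w v)      ∎

  -- Powers of one matrix multiply by adding exponents. Each entry is thereby a scalar double sum
  -- with a matrix factor depending on j + k only, which can be pulled out of every diagonal.
  powerSum-⊗-powerSum : ∀ a b (B : SquareMatrix) N u v →
    (powerSum a B N ⊗ powerSum b B N) u v ≈ rectangle N N (λ j k → (B ^ (j ℕ.+ k)) u v * (a j * b k))
  powerSum-⊗-powerSum a b B N u v = begin
    sum (λ w → sum {N} (x w) * sum {N} (y w))
      ≈⟨ ∑-cong n (λ w → *-distribʳ-sum {N} (sum {N} (y w)) (x w)) ⟩
    sum (λ w → sum {N} (λ j → x w j * sum {N} (y w)))
      ≈⟨ ∑-cong n (λ w → ∑-cong N (λ j → *-distribˡ-sum {N} (x w j) (y w))) ⟩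
    sum (λ w → sum {N} (λ j → sum {N} (λ k → x w j * y w k)))
      ≈⟨ ∑-comm {n} {N} (λ w j → sum {N} (λ k → x w j * y w k)) ⟩
    sum {N} (λ j → sum (λ w → sum {N} (λ k → x w j * y w k)))
      ≈⟨ ∑-cong N (λ j → ∑-comm {n} {N} (λ w k → x w j * y w k)) ⟩
    sum {N} (λ j → sum {N} (λ k → sum (λ w → x w j * y w k)))
      ≈⟨ ∑-cong N (λ j → ∑-cong N (λ k → term (toℕ j) (toℕ k))) ⟩
    rectangle N N (λ j k → (B ^ (j ℕ.+ k)) u v * (a j * b k))
      ∎
    where
    x y : Fin n → Fin N → Carrier
    x w j = a (toℕ j) * (B ^ toℕ j) u w
    y w k = b (toℕ k) * (B ^ toℕ k) w v

    term : ∀ j k → sum (λ w → a j * (B ^ j) u w * (b k * (B ^ k) w v)) ≈ (B ^ (j ℕ.+ k)) u v * (a j * b k)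
    term j k = begin
      sum (λ w → a j * (B ^ j) u w * (b k * (B ^ k) w v))
        ≈⟨ ∑-cong n (λ w → solve 4 (λ p q r s → p :* q :* (r :* s) := q :* s :* (p :* r)) refl _ _ _ _) ⟩
      sum (λ w → (B ^ j) u w * (B ^ k) w v * (a j * b k))
        ≈⟨ *-distribʳ-sum {n} (a j * b k) (λ w → (B ^ j) u w * (B ^ k) w v) ⟨
      (B ^ j ⊗ B ^ k) u v * (a j * b k)
        ≈⟨ *-congʳ (^-+ B j k u v) ⟨
      (B ^ (j ℕ.+ k)) u v * (a j * b k)
        ∎

-- Decay of xᵏ / k!.

module Factorials (em : ExcludedMiddle 0ℓ) (F : CompleteOrderedField) where

  open RealAnalysis em F hiding (zero)
  open Algebra.Properties.Semiring.Mult semiring using (×1-homo-*)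

  1/_! : ℕ → Carrier
  1/ k ! = fromℕ (k !) ⁻¹

  0<k! : ∀ k → 0# < fromℕ (k !)
  0<k! k = 0<fromℕ (k !) {{k ℕ.!≢0}}

  0<1/k! : ∀ k → 0# < 1/ k !
  0<1/k! k = 0<x⁻¹ (0<k! k)

  -- In terms of coefficients, the exponential series is its own derivative. The same recursion
  -- gives the ratio x / (k + 1) of successive terms xᵏ / k!.
  [1+k]/[1+k]! : ∀ k → fromℕ (suc k) * 1/ (suc k) ! ≈ 1/ k !
  [1+k]/[1+k]! k = *-cancelˡ (0<⇒≉0 (0<k! k)) (begin
    fromℕ (k !) * (fromℕ (suc k) * 1/ (suc k) !)    ≈⟨ solve 3 (λ a b c → a :* (b :* c) := b :* a :* c) refl _ _ _ ⟩
    fromℕ (suc k) * fromℕ (k !) * 1/ (suc k) !      ≈⟨ *-congʳ (×1-homo-* (suc k) (k !)) ⟨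
    fromℕ (suc k !) * 1/ (suc k) !                  ≈⟨ *-inverseʳ _ (0<⇒≉0 (0<k! (suc k))) ⟩
    1#                                              ≈⟨ *-inverseʳ _ (0<⇒≉0 (0<k! k)) ⟨
    fromℕ (k !) * 1/ k !                            ∎)
    where open ≈-Reasoning

  0≤x^k : ∀ {x} → 0# ≤ x → ∀ k → 0# ≤ x ^ʳ k
  0≤x^k 0≤x zero    = 0≤1
  0≤x^k 0≤x (suc k) = *-nonNegative 0≤x (0≤x^k 0≤x k)

  eventually-decreasing⇒bounded : ∀ (x : ℕ → Carrier) → (∀ k → 0# ≤ x k) →
    ∀ K → (∀ k → K ℕ.≤ k → x (suc k) ≤ x k) → ∃[ C ] ∀ k → x k ≤ C
  eventually-decreasing⇒bounded x 0≤x zero decreasing = x 0 , bound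
    where
    bound : ∀ k → x k ≤ x 0
    bound zero    = ≤-refl
    bound (suc k) = ≤-trans (decreasing k z≤n) (bound k)
  eventually-decreasing⇒bounded x 0≤x (suc K) decreasing =
    let (C , bound) = eventually-decreasing⇒bounded (x ∘ suc) (0≤x ∘ suc) K (λ k K≤k → decreasing (suc k) (s≤s K≤k))
    in x 0 + C , λ
      { zero    → ≤-by (solve 2 (λ x c → x :+ c :- x := c) refl (x 0) C) (≤-trans (0≤x 1) (bound 0))
      ; (suc k) → ≤-trans (bound k) (≤-by (solve 2 (λ x c → x :+ c :- c := x) refl (x 0) C) (0≤x 0))
      }

  -- The terms decrease as soon as k ≥ x, since their ratio is x / (k + 1); a natural number above
  -- `x` marks the place.
  x^k/k!-bounded : ∀ {x} → 0# ≤ x → ∃[ C ] ∀ k → 1/ k ! * x ^ʳ k ≤ C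
  x^k/k!-bounded {x} 0≤x =
    let (K , x≤K) = archimedean x
    in eventually-decreasing⇒bounded _ (λ k → *-nonNegative (<⇒≤ (0<1/k! k)) (0≤x^k 0≤x k)) K λ k K≤k →
         ≤-respˡ-≈ (*-assoc _ _ _) (*-monoˡ-≤ (0≤x^k 0≤x k)
           (≤-trans (*-monoʳ-≤ (<⇒≤ (0<1/k! (suc k))) (≤-trans x≤K (fromℕ-mono-≤ (ℕ.m≤n⇒m≤1+n K≤k))))
             (≤-reflexive (trans (*-comm _ _) ([1+k]/[1+k]! k)))))

  -- In the Cauchy product the rows decay like ¼ʲ and the columns like ½ᵏ. With rate ½ for both,
  -- each of the N rows would contribute order ½ᴺ outside the triangle, leaving a bound of order N ·
  -- ½ᴺ; with ¼ the row contributions form a geometric series.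
  ¼ : Carrier
  ¼ = ½ * ½

  ¼^k≤½^k : ∀ k → ¼ ^ʳ k ≤ ½ ^ʳ k
  ¼^k≤½^k zero    = ≤-refl
  ¼^k≤½^k (suc k) = *-mono-≤ (<⇒≤ 0<½) (0≤x^k (<⇒≤ (0<x*y 0<½ 0<½)) k)
    (≤-trans (*-monoʳ-≤ (<⇒≤ 0<½) (≤-by (trans (+-congʳ (sym ½+½≈1)) (solve 1 (λ h → h :+ h :- h := h) refl ½)) (<⇒≤ 0<½)))
      (≤-reflexive (*-identityʳ ½)))
    (¼^k≤½^k k)

  -- The terms for `4x` are bounded, and dividing the k-th of them by 4ᵏ gives the term for `x`.
  x^k/k!-geometric : ∀ {x} → 0# ≤ x → ∃[ C ] ∀ k → 1/ k ! * x ^ʳ k ≤ C * ¼ ^ʳ k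
  x^k/k!-geometric {x} 0≤x =
    let (C , bound) = x^k/k!-bounded (*-nonNegative (<⇒≤ 0<4) 0≤x)
    in C , λ k → ≤-respˡ-≈ (trans (*-assoc _ _ _) (*-congˡ (cancel k)))
                   (*-monoˡ-≤ (0≤x^k (<⇒≤ (0<x*y 0<½ 0<½)) k) (bound k))
    where
    2# 4# : Carrier
    2# = 1# + 1#
    4# = 2# * 2#

    0<4 : 0# < 4#
    0<4 = 0<x*y 0<2 0<2

    4*¼≈1 : 4# * ¼ ≈ 1#
    4*¼≈1 = begin
      4# * ¼                  ≈⟨ solve 2 (λ t h → t :* t :* (h :* h) := t :* h :* (t :* h)) refl 2# ½ ⟩
      2# * ½ * (2# * ½)       ≈⟨ *-cong 2*½≈1 2*½≈1 ⟩
      1# * 1#                 ≈⟨ *-identityˡ 1# ⟩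
      1#                      ∎
      where
      open ≈-Reasoning
      2*½≈1 = *-inverseʳ 2# (0<⇒≉0 0<2)

    cancel : ∀ k → (4# * x) ^ʳ k * ¼ ^ʳ k ≈ x ^ʳ k
    cancel zero    = *-identityˡ 1#
    cancel (suc k) = begin
      4# * x * (4# * x) ^ʳ k * (¼ * ¼ ^ʳ k)       ≈⟨ solve 5 (λ f x p q r → f :* x :* p :* (q :* r) := f :* q :* (x :* (p :* r))) refl _ _ _ _ _ ⟩
      4# * ¼ * (x * ((4# * x) ^ʳ k * ¼ ^ʳ k))     ≈⟨ *-cong 4*¼≈1 (*-congˡ (cancel k)) ⟩
      1# * (x * x ^ʳ k)                           ≈⟨ *-identityˡ _ ⟩
      x * x ^ʳ k                                  ∎
      where open ≈-Reasoning

-- Geometrically bounded series and the exponential coefficients.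

module Series (em : ExcludedMiddle 0ℓ) (F : CompleteOrderedField) where

  open UniformMixing em F hiding (_-_)
  open ComplexAnalysis em F
  open DoubleSums ℂ-commutativeRing
  open Factorials em F using (1/_!; [1+k]/[1+k]!; ¼)
  open ℝ using (½)

  fromℝ-cong : ∀ {x y} → x ℝ.≈ y → fromℝ x ≈ fromℝ y
  fromℝ-cong x≈y = x≈y , ℝ.refl

  fromℝ-+ : ∀ x y → fromℝ (x ℝ.+ y) ≈ fromℝ x + fromℝ y
  fromℝ-+ x y = ℝ.refl , ℝ.sym (ℝ.+-identityˡ ℝ.0#)

  fromℝ-* : ∀ x y → fromℝ (x ℝ.* y) ≈ fromℝ x * fromℝ y
  fromℝ-* x y =
    ℝ.solve 2 (λ x y → x ℝ.:* y ℝ.:= x ℝ.:* y ℝ.:- ℝ.con +0 ℝ.:* ℝ.con +0) ℝ.refl x y ,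
    ℝ.solve 2 (λ x y → ℝ.con +0 ℝ.:= x ℝ.:* ℝ.con +0 ℝ.:+ ℝ.con +0 ℝ.:* y) ℝ.refl x y

  ℕ⇒ℂ : ℕ → ℂ
  ℕ⇒ℂ n = fromℝ (ℝ.fromℕ n)

  ℕ⇒ℂ-+ : ∀ m n → ℕ⇒ℂ (m ℕ.+ n) ≈ ℕ⇒ℂ m + ℕ⇒ℂ n
  ℕ⇒ℂ-+ zero    n = sym (+-identityˡ _)
  ℕ⇒ℂ-+ (suc m) n = begin
    fromℝ (ℝ.1# ℝ.+ ℝ.fromℕ (m ℕ.+ n))    ≈⟨ fromℝ-+ _ _ ⟩
    1# + ℕ⇒ℂ (m ℕ.+ n)                     ≈⟨ +-congˡ (ℕ⇒ℂ-+ m n) ⟩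
    1# + (ℕ⇒ℂ m + ℕ⇒ℂ n)                   ≈⟨ +-assoc _ _ _ ⟨
    1# + ℕ⇒ℂ m + ℕ⇒ℂ n                     ≈⟨ +-congʳ (fromℝ-+ _ _) ⟨
    ℕ⇒ℂ (suc m) + ℕ⇒ℂ n                    ∎
    where open ≈-Reasoning

  fromℝ-cancel : ∀ {x z} → ¬ x ℝ.≈ ℝ.0# → fromℝ x * z ≈ 0# → z ≈ 0#
  fromℝ-cancel {x} {z} x≉0 xz≈0 = begin
    z                                 ≈⟨ *-identityˡ z ⟨
    1# * z                            ≈⟨ *-congʳ (fromℝ-cong (ℝ.*-inverseˡ x≉0)) ⟨
    fromℝ (x ℝ.⁻¹ ℝ.* x) * z          ≈⟨ *-congʳ (fromℝ-* _ _) ⟩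
    fromℝ (x ℝ.⁻¹) * fromℝ x * z      ≈⟨ *-assoc _ _ _ ⟩
    fromℝ (x ℝ.⁻¹) * (fromℝ x * z)    ≈⟨ *-congˡ xz≈0 ⟩
    fromℝ (x ℝ.⁻¹) * 0#               ≈⟨ zeroʳ _ ⟩
    0#                                ∎
    where open ≈-Reasoning

  shift : ∀ {f : ℕ → ℂ} {C} → (∀ k → Bounded (f k) (C ℝ.* ½ ℝ.^ʳ k)) →
          ∀ k → Bounded (f (suc k)) (½ ℝ.* C ℝ.* ½ ℝ.^ʳ k)
  shift {C = C} f-bounded k = bounded-weaken (ℝ.≤-reflexive
    (ℝ.solve 3 (λ c h p → c ℝ.:* (h ℝ.:* p) ℝ.:= h ℝ.:* c ℝ.:* p) ℝ.refl C ½ (½ ℝ.^ʳ k))) (f-bounded (suc k))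

  -- The bound 2C reproduces itself: the first term contributes C, and the remaining ones satisfy
  -- the hypothesis with ½C, hence contribute 2 · ½C.
  partialSum-bounded : ∀ {f C} → (∀ k → Bounded (f k) (C ℝ.* ½ ℝ.^ʳ k)) →
                       ∀ N → Bounded (partialSum f N) (C ℝ.+ C)
  partialSum-bounded {f} {C} f-bounded zero =
    bounded-0 (ℝ.0≤x+y 0≤C 0≤C)
    where
    0≤C = ℝ.≤-respʳ-≈ (ℝ.*-identityʳ C) (bounded-nonNegative (f-bounded 0))
  partialSum-bounded {f} {C} f-bounded (suc N) = bounded-weaken
    (ℝ.≤-reflexive (ℝ.+-cong (ℝ.*-identityʳ C) (ℝ.½x+½x≈x C)))
    (bounded-+ (f-bounded 0) (partialSum-bounded (shift {f} f-bounded) N))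

  partialSum-tail : ∀ {f C} → (∀ k → Bounded (f k) (C ℝ.* ½ ℝ.^ʳ k)) →
                    ∀ {N M} → N ℕ.≤ M → Bounded (partialSum f M - partialSum f N) ((C ℝ.+ C) ℝ.* ½ ℝ.^ʳ N)
  partialSum-tail {f} {C} f-bounded {M = M} z≤n = bounded-weaken
    (ℝ.≤-reflexive (ℝ.sym (ℝ.*-identityʳ _)))
    (bounded-cong (solve 1 (λ s → s := s :- con +0) refl (partialSum f M)) (partialSum-bounded f-bounded M))
  partialSum-tail {f} {C} f-bounded {suc N} {suc M} (s≤s N≤M) = bounded-weaken
    (ℝ.≤-reflexive (ℝ.solve 3 (λ c h p → (h ℝ.:* c ℝ.:+ h ℝ.:* c) ℝ.:* p ℝ.:= (c ℝ.:+ c) ℝ.:* (h ℝ.:* p)) ℝ.refl C ½ (½ ℝ.^ʳ N)))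
    (bounded-cong (solve 3 (λ a s t → s :- t := a :+ s :- (a :+ t)) refl (f 0) (partialSum (f ∘ suc) M) (partialSum (f ∘ suc) N))
      (partialSum-tail (shift {f} f-bounded) N≤M))

  series-converges : ∀ {f C} → (∀ k → Bounded (f k) (C ℝ.* ½ ℝ.^ʳ k)) → ∃[ l ] partialSum f ⇝ l
  series-converges {C = C} f-bounded = geometric-cauchy (C ℝ.+ C) λ N p → partialSum-tail f-bounded (ℕ.m≤m+n N p)

  -- Row 0 contributes C · ½ᴺ, and the remaining rows satisfy the hypothesis with C · ¼ in place of C.
  rectangle-triangle : ∀ {a C} → (∀ j k → Bounded (a j k) (C ℝ.* ¼ ℝ.^ʳ j ℝ.* ½ ℝ.^ʳ k)) →
                       ∀ {N Q} → N ℕ.≤ Q → Bounded (rectangle N Q a - triangle N a) ((C ℝ.+ C ℝ.+ (C ℝ.+ C)) ℝ.* ½ ℝ.^ʳ N)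
  rectangle-triangle {a} {C} a-bounded {zero} _ =
    bounded-cong (solve 0 (con +0 := con +0 :- con +0) refl)
      (bounded-0 (ℝ.≤-respʳ-≈ (ℝ.sym (ℝ.*-identityʳ _)) (ℝ.0≤x+y (ℝ.0≤x+y 0≤C 0≤C) (ℝ.0≤x+y 0≤C 0≤C))))
    where
    0≤C = ℝ.≤-respʳ-≈ (ℝ.trans (ℝ.*-identityʳ _) (ℝ.*-identityʳ C)) (bounded-nonNegative (a-bounded 0 0))
  rectangle-triangle {a} {C} a-bounded {suc N} {Q} N<Q = bounded-weaken (ℝ.≤-reflexive (count (½ ℝ.^ʳ N)))
    (bounded-cong (solve 4 (λ s t r d → s :- t :+ (r :- d) := s :+ r :- (t :+ d)) refl
        (partialSum (a 0) Q) (partialSum (a 0) (suc N)) (rectangle N Q (a ∘ suc)) (triangle N (a ∘ suc)))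
      (bounded-+
        (partialSum-tail (λ k → bounded-weaken (ℝ.≤-reflexive (ℝ.*-congʳ (ℝ.*-identityʳ C))) (a-bounded 0 k)) N<Q)
        (rectangle-triangle {C = C ℝ.* ¼} (λ j k → bounded-weaken
            (ℝ.≤-reflexive (ℝ.*-congʳ (ℝ.sym (ℝ.*-assoc C ¼ (¼ ℝ.^ʳ j))))) (a-bounded (suc j) k))
          (ℕ.≤-trans (ℕ.n≤1+n N) N<Q))))
    where
    -- Row 0 misses at most 2C · ½ᴺ⁺¹ and the other rows 4 · (C · ¼) · ½ᴺ = 2C · ½ᴺ⁺¹, together 4C ·
    -- ½ᴺ⁺¹.
    count : ∀ p → (C ℝ.+ C) ℝ.* (½ ℝ.* p) ℝ.+ (C ℝ.* ¼ ℝ.+ C ℝ.* ¼ ℝ.+ (C ℝ.* ¼ ℝ.+ C ℝ.* ¼)) ℝ.* p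
                  ℝ.≈ (C ℝ.+ C ℝ.+ (C ℝ.+ C)) ℝ.* (½ ℝ.* p)
    count p = ℝ.trans
      (ℝ.solve 3 (λ c h p →
        (c ℝ.:+ c) ℝ.:* (h ℝ.:* p) ℝ.:+ (c ℝ.:* (h ℝ.:* h) ℝ.:+ c ℝ.:* (h ℝ.:* h) ℝ.:+ (c ℝ.:* (h ℝ.:* h) ℝ.:+ c ℝ.:* (h ℝ.:* h))) ℝ.:* p
          ℝ.:= (c ℝ.:+ c) ℝ.:* (h ℝ.:* p) ℝ.:+ (h ℝ.:+ h) ℝ.:* ((c ℝ.:+ c) ℝ.:* (h ℝ.:* p))) ℝ.refl C ½ p)
      (ℝ.trans (ℝ.+-congˡ (ℝ.trans (ℝ.*-congʳ ℝ.½+½≈1) (ℝ.*-identityˡ _)))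
        (ℝ.solve 2 (λ c p → c ℝ.:* p ℝ.:+ c ℝ.:* p ℝ.:= (c ℝ.:+ c) ℝ.:* p) ℝ.refl (C ℝ.+ C) (½ ℝ.* p)))

  α : ℕ → ℂ
  α k = fromℝ (1/ k !)

  [-1]^_ : ℕ → ℂ
  [-1]^ zero  = 1#
  [-1]^ suc k = - ([-1]^ k)

  β : ℕ → ℂ
  β k = [-1]^ k * α k

  α-suc : ∀ k → ℕ⇒ℂ (suc k) * α (suc k) ≈ α k
  α-suc k = trans (sym (fromℝ-* _ _)) (fromℝ-cong ([1+k]/[1+k]! k))

  β-suc : ∀ k → ℕ⇒ℂ (suc k) * β (suc k) ≈ - β k
  β-suc k = trans (solve 3 (λ n s a → n :* ((:- s) :* a) := :- (s :* (n :* a))) refl (ℕ⇒ℂ (suc k)) ([-1]^ k) (α (suc k)))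
    (-‿cong (*-congˡ (α-suc k)))

  -- This coefficient is (1 - 1)ᴺ⁺¹ / (N + 1)!. The derivative identity shows that it vanishes after
  -- multiplication by N + 1, and N + 1 is invertible.
  exp-diagonal-vanishes : ∀ N → diagonal (suc N) (λ j k → α j * β k) ≈ 0#
  exp-diagonal-vanishes N = fromℝ-cancel (ℝ.0<⇒≉0 (ℝ.0<fromℕ (suc N)))
    (diagonal-derivative ℕ⇒ℂ α β refl ℕ⇒ℂ-+ α-suc β-suc N)

-- The matrix exponential: convergence, symmetry, commutation, unitarity.

module MatrixExponential (em : ExcludedMiddle 0ℓ) (F : CompleteOrderedField) (n : ℕ) where

  module UM = UniformMixing em F
  open UM using (ℝ; ℂ; re; im; fromℝ; conj; exp; conjᴹ)
  open ComplexAnalysis em F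
  open DoubleSums ℂ-commutativeRing
  open Matrices ℂ-commutativeRing n
  open Factorials em F using (1/_!; 0<1/k!; ¼; 0≤x^k; ¼^k≤½^k; x^k/k!-geometric)
  open Series em F
  open ℝ using (½)

  common-bound : ∀ {k} (P : Fin k → ℝ → Set) → (∀ i {c d} → c ℝ.≤ d → P i c → P i d) →
                 (∀ i → ∃[ c ] ℝ.0# ℝ.≤ c × P i c) → ∃[ c ] ℝ.0# ℝ.≤ c × ∀ i → P i c
  common-bound {zero}  P mono bound = ℝ.0# , ℝ.≤-refl , λ ()
  common-bound {suc k} P mono bound =
    let (c , 0≤c , Pc) = bound zero
        (d , 0≤d , Pd) = common-bound (P ∘ suc) (λ i → mono (suc i)) (λ i → bound (suc i))
    in c ℝ.+ d , ℝ.0≤x+y 0≤c 0≤d , λ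
      { zero    → mono zero (ℝ.≤-by (ℝ.solve 2 (λ c d → c ℝ.:+ d ℝ.:- c ℝ.:= d) ℝ.refl c d) 0≤d) Pc
      ; (suc i) → mono (suc i) (ℝ.≤-by (ℝ.solve 2 (λ c d → c ℝ.:+ d ℝ.:- d ℝ.:= c) ℝ.refl c d) 0≤c) (Pd i)
      }

  entries-bounded : ∀ (B : SquareMatrix) → ∃[ c ] ℝ.0# ℝ.≤ c × ∀ u v → Bounded (B u v) c
  entries-bounded B = common-bound (λ u c → ∀ v → Bounded (B u v) c)
    (λ u c≤d B≤c v → bounded-weaken c≤d (B≤c v))
    (λ u → common-bound (λ v c → Bounded (B u v) c) (λ v → bounded-weaken)
      (λ v → let (c , B≤c) = ∃bounded (B u v) in c , bounded-nonNegative B≤c , B≤c))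

  2ℝ : ℝ
  2ℝ = ℝ.1# ℝ.+ ℝ.1#

  I-bounded : ∀ (u v : Fin n) → Bounded (I u v) 2ℝ
  I-bounded u v = bounded (does (u ≟ v))
    where
    bounded : ∀ b → Bounded (if b then 1# else 0#) 2ℝ
    bounded true  = bounded-fromℝ ℝ.0≤1
    bounded false = bounded-0 (ℝ.<⇒≤ ℝ.0<2)

  -- Every further factor `B` costs a sum of `n` products, hence nc; the leading `2ℝ` is the doubled
  -- entry 1 of `B ^ 0`.
  ^-bounded : ∀ (B : SquareMatrix) {c} → (∀ u v → Bounded (B u v) c) →
              ∀ k u v → Bounded ((B ^ k) u v) (2ℝ ℝ.* (ℝ.fromℕ n ℝ.* c) ℝ.^ʳ k)
  ^-bounded B B≤c zero u v = bounded-weaken (ℝ.≤-reflexive (ℝ.sym (ℝ.*-identityʳ 2ℝ))) (I-bounded u v)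
  ^-bounded B {c} B≤c (suc k) u v = bounded-weaken
    (ℝ.≤-reflexive (ℝ.solve 4 (λ n c t p → n ℝ.:* (c ℝ.:* (t ℝ.:* p)) ℝ.:= t ℝ.:* (n ℝ.:* c ℝ.:* p)) ℝ.refl
      (ℝ.fromℕ n) c 2ℝ ((ℝ.fromℕ n ℝ.* c) ℝ.^ʳ k)))
    (bounded-sum {z = λ w → B u w * (B ^ k) w v} (λ w → bounded-* (B≤c u w) (^-bounded B B≤c k w v)))

  [-1]^-bounded : ∀ k {z c} → Bounded z c → Bounded ([-1]^ k * z) c
  [-1]^-bounded zero    {z} z≤c = bounded-cong (sym (*-identityˡ z)) z≤c
  [-1]^-bounded (suc k) {z} z≤c = bounded-cong
    (solve 2 (λ s z → :- (s :* z) := (:- s) :* z) refl ([-1]^ k) z)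
    (bounded-neg ([-1]^-bounded k z≤c))

  α-bounded : ∀ k → Bounded (α k) (1/ k ! ℝ.+ 1/ k !)
  α-bounded k = bounded-fromℝ (ℝ.<⇒≤ (0<1/k! k))

  β-bounded : ∀ k → Bounded (β k) (1/ k ! ℝ.+ 1/ k !)
  β-bounded k = [-1]^-bounded k (α-bounded k)

  exp-terms-bounded : ∀ (B : SquareMatrix) →
                      ∃[ C ] ∀ k u v → Bounded (α k * (B ^ k) u v) (C ℝ.* ½ ℝ.^ʳ k)
  exp-terms-bounded B =
    let (c , 0≤c , B≤c) = entries-bounded B
        (C , decay) = x^k/k!-geometric (ℝ.*-nonNegative (ℝ.0≤fromℕ n) 0≤c)
    in 4ℝ ℝ.* C , λ k u v → bounded-weaken (estimate decay k) (bounded-* (α-bounded k) (^-bounded B B≤c k u v))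
    where
    4ℝ : ℝ
    4ℝ = 2ℝ ℝ.* 2ℝ

    0≤4 : ℝ.0# ℝ.≤ 4ℝ
    0≤4 = ℝ.<⇒≤ (ℝ.0<x*y ℝ.0<2 ℝ.0<2)

    estimate : ∀ {b C} → (∀ k → 1/ k ! ℝ.* b ℝ.^ʳ k ℝ.≤ C ℝ.* ¼ ℝ.^ʳ k) →
               ∀ k → (1/ k ! ℝ.+ 1/ k !) ℝ.* (2ℝ ℝ.* b ℝ.^ʳ k) ℝ.≤ 4ℝ ℝ.* C ℝ.* ½ ℝ.^ʳ k
    estimate {b} {C} decay k =
      ℝ.≤-trans (ℝ.≤-reflexive (ℝ.solve 2 (λ i p →
          (i ℝ.:+ i) ℝ.:* ((ℝ.con (+ 1) ℝ.:+ ℝ.con (+ 1)) ℝ.:* p)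
            ℝ.:= (ℝ.con (+ 1) ℝ.:+ ℝ.con (+ 1)) ℝ.:* (ℝ.con (+ 1) ℝ.:+ ℝ.con (+ 1)) ℝ.:* (i ℝ.:* p))
          ℝ.refl (1/ k !) (b ℝ.^ʳ k)))
        (ℝ.≤-trans (ℝ.*-monoʳ-≤ 0≤4 (ℝ.≤-trans (decay k) (ℝ.*-monoʳ-≤ 0≤C (¼^k≤½^k k))))
          (ℝ.≤-reflexive (ℝ.sym (ℝ.*-assoc 4ℝ C (½ ℝ.^ʳ k)))))
      where
      0≤C : ℝ.0# ℝ.≤ C
      0≤C = ℝ.≤-trans (ℝ.*-nonNegative (ℝ.<⇒≤ (0<1/k! 0)) ℝ.0≤1)
        (ℝ.≤-trans (decay 0) (ℝ.≤-reflexive (ℝ.*-identityʳ C)))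

  ^-agrees : ∀ (B : SquareMatrix) k → B ^ k ≋ (B UM.^ k)
  ^-agrees B zero    u v = refl
  ^-agrees B (suc k) u v = ⊗-congˡ B (^-agrees B k) u v

  -- The geometric bound on the terms provides a limit, and this rules out the default value of
  -- `lim`. From here on `exp` is handled through its truncations and the uniqueness of limits.
  exp-converges : ∀ (B : SquareMatrix) u v → (λ N → powerSum α B N u v) ⇝ exp B u v
  exp-converges B u v = ⇝-cong (λ N → sym (agrees N)) refl (lim-⇝ (⇝-cong agrees refl (proj₂ convergent)))
    where
    convergent : ∃[ l ] partialSum (λ k → α k * (B ^ k) u v) ⇝ l
    convergent = let (C , bound) = exp-terms-bounded B in series-converges (λ k → bound k u v)

    agrees : ∀ N → partialSum (λ k → α k * (B ^ k) u v) N ≈ partialSum (λ k → α k * (B UM.^ k) u v) N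
    agrees = partialSum-cong (λ k → *-congˡ {α k} (^-agrees B k u v))

  exp-symmetric : ∀ (B : SquareMatrix) → (∀ u v → B u v ≈ B v u) → ∀ u v → exp B u v ≈ exp B v u
  exp-symmetric B B-sym u v = ⇝-unique (exp-converges B u v)
    (⇝-cong (partialSum-cong (λ k → *-congˡ {α k} (^-symmetric B B-sym k v u))) refl (exp-converges B v u))

  ⊗-⇝ : ∀ {B C : ℕ → SquareMatrix} {K L : SquareMatrix} → (∀ u v → (λ m → B m u v) ⇝ K u v) →
        (∀ u v → (λ m → C m u v) ⇝ L u v) → ∀ u v → (λ m → (B m ⊗ C m) u v) ⇝ (K ⊗ L) u v
  ⊗-⇝ B⇝K C⇝L u v = ⇝-sum (λ w → ⇝-* (B⇝K u w) (C⇝L w v))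

  exp-comm : ∀ (C B : SquareMatrix) → C ⊗ B ≋ B ⊗ C → C ⊗ exp B ≋ exp B ⊗ C
  exp-comm C B comm u v = ⇝-unique
    (⊗-⇝ (λ u v → ⇝-const (C u v)) (exp-converges B) u v)
    (⇝-cong (λ N → sym (⊗-powerSum-comm α C B comm N u v)) refl
      (⊗-⇝ (exp-converges B) (λ u v → ⇝-const (C u v)) u v))

  conj-cong : ∀ {z w} → z ≈ w → conj z ≈ conj w
  conj-cong (p , q) = p , ℝ.-‿cong q

  conj-+ : ∀ z w → conj (z + w) ≈ conj z + conj w
  conj-+ z w = ℝ.refl , ℝ.solve 2 (λ a b → ℝ.:- (a ℝ.:+ b) ℝ.:= (ℝ.:- a) ℝ.:+ (ℝ.:- b)) ℝ.refl (im z) (im w)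

  conj-* : ∀ z w → conj (z * w) ≈ conj z * conj w
  conj-* z w =
    ℝ.solve 4 (λ a b c d → a ℝ.:* c ℝ.:- b ℝ.:* d ℝ.:= a ℝ.:* c ℝ.:- (ℝ.:- b) ℝ.:* (ℝ.:- d)) ℝ.refl
      (re z) (im z) (re w) (im w) ,
    ℝ.solve 4 (λ a b c d → ℝ.:- (a ℝ.:* d ℝ.:+ b ℝ.:* c) ℝ.:= a ℝ.:* (ℝ.:- d) ℝ.:+ (ℝ.:- b) ℝ.:* c) ℝ.refl
      (re z) (im z) (re w) (im w)

  conj-fromℝ : ∀ x → conj (fromℝ x) ≈ fromℝ x
  conj-fromℝ x = ℝ.refl , ℝ.-0#≈0#

  conj-sum : ∀ {k} (f : Fin k → ℂ) → conj (sum f) ≈ sum (λ i → conj (f i))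
  conj-sum {zero}  f = conj-fromℝ ℝ.0#
  conj-sum {suc k} f = trans (conj-+ (f zero) (sum (f ∘ suc))) (+-congˡ (conj-sum (f ∘ suc)))

  module _ (B : SquareMatrix) (skew : ∀ u v → conj (B u v) ≈ - B u v) where

    conj-I : ∀ (u v : Fin n) → conj (I u v) ≈ I u v
    conj-I u v = real (does (u ≟ v))
      where
      real : ∀ b → conj (if b then 1# else 0#) ≈ (if b then 1# else 0#)
      real true  = conj-fromℝ ℝ.1#
      real false = conj-fromℝ ℝ.0#

    conj-^ : ∀ k u v → conj ((B ^ k) u v) ≈ [-1]^ k * (B ^ k) u v
    conj-^ zero    u v = trans (conj-I u v) (sym (*-identityˡ (I u v)))
    conj-^ (suc k) u v = begin
      conj (sum (λ w → B u w * (B ^ k) w v))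
        ≈⟨ conj-sum (λ w → B u w * (B ^ k) w v) ⟩
      sum (λ w → conj (B u w * (B ^ k) w v))
        ≈⟨ ∑-cong n (λ w → term w) ⟩
      sum (λ w → [-1]^ suc k * (B u w * (B ^ k) w v))
        ≈⟨ *-distribˡ-sum {n} ([-1]^ suc k) (λ w → B u w * (B ^ k) w v) ⟨
      [-1]^ suc k * (B ^ suc k) u v
        ∎
      where
      open ≈-Reasoning
      term : ∀ w → conj (B u w * (B ^ k) w v) ≈ [-1]^ suc k * (B u w * (B ^ k) w v)
      term w = begin
        conj (B u w * (B ^ k) w v)              ≈⟨ conj-* (B u w) ((B ^ k) w v) ⟩
        conj (B u w) * conj ((B ^ k) w v)       ≈⟨ *-cong (skew u w) (conj-^ k w v) ⟩
        - B u w * ([-1]^ k * (B ^ k) w v)       ≈⟨ solve 3 (λ b s p → (:- b) :* (s :* p) := (:- s) :* (b :* p)) refl (B u w) ([-1]^ k) ((B ^ k) w v) ⟩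
        [-1]^ suc k * (B u w * (B ^ k) w v)     ∎

    -- For imaginary entries, conjugating exp B gives exp (-B). The signs are moved from the matrix
    -- into the coefficients `β`, so that both factors are power sums of the same `B`.
    conj-powerSum : ∀ N u v → conj (powerSum α B N u v) ≈ powerSum β B N u v
    conj-powerSum N u v = trans (conj-sum {N} (λ k → α (toℕ k) * (B ^ toℕ k) u v)) (∑-cong N (λ k → term (toℕ k)))
      where
      open ≈-Reasoning
      term : ∀ k → conj (α k * (B ^ k) u v) ≈ β k * (B ^ k) u v
      term k = begin
        conj (α k * (B ^ k) u v)              ≈⟨ conj-* (α k) ((B ^ k) u v) ⟩
        conj (α k) * conj ((B ^ k) u v)       ≈⟨ *-cong (conj-fromℝ (1/ k !)) (conj-^ k u v) ⟩
        α k * ([-1]^ k * (B ^ k) u v)         ≈⟨ solve 3 (λ a s p → a :* (s :* p) := s :* a :* p) refl (α k) ([-1]^ k) ((B ^ k) u v) ⟩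
        β k * (B ^ k) u v                     ∎

    product-terms : Fin n → Fin n → ℕ → ℕ → ℂ
    product-terms u v j k = (B ^ (j ℕ.+ k)) u v * (α j * β k)

    product-terms-bounded : ∃[ C ] ∀ u v j k →
      Bounded (product-terms u v j k) (C ℝ.* ¼ ℝ.^ʳ j ℝ.* ½ ℝ.^ʳ k)
    product-terms-bounded =
      let (c , 0≤c , B≤c) = entries-bounded B
          (C , decay) = x^k/k!-geometric (ℝ.*-nonNegative (ℝ.0≤fromℕ n) 0≤c)
      in 8ℝ ℝ.* (C ℝ.* C) , λ u v j k → bounded-weaken (estimate (ℝ.*-nonNegative (ℝ.0≤fromℕ n) 0≤c) decay j k)
           (bounded-* (^-bounded B B≤c (j ℕ.+ k) u v) (bounded-* (α-bounded j) (β-bounded k)))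
      where
      open Algebra.Properties.Semiring.Exp ℝ.semiring using (^-homo-*)

      -- One factor 2 comes from the bound on the power and one from each of the two coefficients.
      -- Below, the row factor keeps ¼ʲ while the column factor is weakened to ½ᵏ.
      8ℝ : ℝ
      8ℝ = 2ℝ ℝ.* (2ℝ ℝ.* 2ℝ)

      estimate : ∀ {b C} → ℝ.0# ℝ.≤ b → (∀ k → 1/ k ! ℝ.* b ℝ.^ʳ k ℝ.≤ C ℝ.* ¼ ℝ.^ʳ k) → ∀ j k →
                 2ℝ ℝ.* b ℝ.^ʳ (j ℕ.+ k) ℝ.* ((1/ j ! ℝ.+ 1/ j !) ℝ.* (1/ k ! ℝ.+ 1/ k !))
                   ℝ.≤ 8ℝ ℝ.* (C ℝ.* C) ℝ.* ¼ ℝ.^ʳ j ℝ.* ½ ℝ.^ʳ k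
      estimate {b} {C} 0≤b decay j k =
        ℝ.≤-trans (ℝ.≤-reflexive (ℝ.trans (ℝ.*-congʳ (ℝ.*-congˡ (^-homo-* b j k)))
          (ℝ.solve 4 (λ p q i l →
            (ℝ.con (+ 1) ℝ.:+ ℝ.con (+ 1)) ℝ.:* (p ℝ.:* q) ℝ.:* ((i ℝ.:+ i) ℝ.:* (l ℝ.:+ l))
              ℝ.:= (ℝ.con (+ 1) ℝ.:+ ℝ.con (+ 1)) ℝ.:* ((ℝ.con (+ 1) ℝ.:+ ℝ.con (+ 1)) ℝ.:* (ℝ.con (+ 1) ℝ.:+ ℝ.con (+ 1)))
                ℝ.:* ((i ℝ.:* p) ℝ.:* (l ℝ.:* q)))
            ℝ.refl (b ℝ.^ʳ j) (b ℝ.^ʳ k) (1/ j !) (1/ k !))))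
        (ℝ.≤-trans (ℝ.*-monoʳ-≤ (ℝ.<⇒≤ (ℝ.0<x*y ℝ.0<2 (ℝ.0<x*y ℝ.0<2 ℝ.0<2)))
            (ℝ.*-mono-≤ (ℝ.≤-trans (0≤term j) (decay j)) (0≤term k) (decay j)
              (ℝ.≤-trans (decay k) (ℝ.*-monoʳ-≤ 0≤C (¼^k≤½^k k)))))
          (ℝ.≤-reflexive (ℝ.solve 4 (λ e C p q → e ℝ.:* ((C ℝ.:* p) ℝ.:* (C ℝ.:* q)) ℝ.:= e ℝ.:* (C ℝ.:* C) ℝ.:* p ℝ.:* q)
            ℝ.refl 8ℝ C (¼ ℝ.^ʳ j) (½ ℝ.^ʳ k))))
        where
        0≤term : ∀ k → ℝ.0# ℝ.≤ 1/ k ! ℝ.* b ℝ.^ʳ k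
        0≤term k = ℝ.*-nonNegative (ℝ.<⇒≤ (0<1/k! k)) (0≤x^k 0≤b k)

        0≤C : ℝ.0# ℝ.≤ C
        0≤C = ℝ.≤-trans (0≤term 0) (ℝ.≤-trans (decay 0) (ℝ.≤-reflexive (ℝ.*-identityʳ C)))

    -- Only degree 0 survives, with B⁰ α₀ β₀ = I. The truncation has to be `suc N`, since the empty
    -- triangle is 0.
    triangle-I : ∀ u v N → triangle (suc N) (product-terms u v) ≈ I u v
    triangle-I u v N = trans (triangle-collapse (product-terms u v) vanish N) (begin
      I u v * (α 0 * (1# * α 0))    ≈⟨ *-congˡ {I u v} (trans (*-cong α0≈1 (trans (*-identityˡ (α 0)) α0≈1)) (*-identityˡ 1#)) ⟩
      I u v * 1#                    ≈⟨ *-identityʳ (I u v) ⟩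
      I u v                         ∎)
      where
      open ≈-Reasoning
      α0≈1 : α 0 ≈ 1#
      α0≈1 = fromℝ-cong (ℝ.trans (ℝ.sym (ℝ.*-identityˡ _)) (ℝ.trans (ℝ.*-congʳ (ℝ.sym (ℝ.+-identityʳ ℝ.1#)))
        (ℝ.*-inverseʳ _ (ℝ.0<⇒≉0 (ℝ.0<fromℕ 1)))))

      vanish : ∀ N → diagonal (suc N) (product-terms u v) ≈ 0#
      vanish N = trans (diagonal-graded (λ m → (B ^ m) u v) (λ j k → α j * β k) (suc N))
        (trans (*-congˡ {(B ^ suc N) u v} (exp-diagonal-vanishes N)) (zeroʳ ((B ^ suc N) u v)))

    -- The products of truncations are square double sums. They converge to the left side, and their
    -- distance to the triangles, all equal to `I`, is a multiple of ½ᴺ. For symmetric `B` the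
    -- conjugate is the adjoint, and the equation says that exp B is unitary.
    exp-unitary : exp B ⊗ conjᴹ (exp B) ≋ I
    exp-unitary u v = ⇝-unique
      -- The sequence is shifted by one index to skip the empty triangle.
      (⇝-extract (λ m → ℕ.n≤1+n m)
        (⊗-⇝ (exp-converges B) (λ u v → ⇝-conj (exp-converges B u v)) u v))
      (converges (null-geometric (C ℝ.+ C ℝ.+ (C ℝ.+ C)) λ N →
        bounded-weaken (ℝ.*-monoʳ-≤ 0≤4C (ℝ.½^-suc-≤ N))
          (bounded-cong (+-cong (sym (product (suc N))) (-‿cong (triangle-I u v N)))
            (rectangle-triangle {C = C} (proj₂ product-terms-bounded u v) {suc N} ℕ.≤-refl))))
      where
      C = proj₁ product-terms-bounded

      0≤C : ℝ.0# ℝ.≤ C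
      0≤C = ℝ.≤-respʳ-≈ (ℝ.trans (ℝ.*-identityʳ _) (ℝ.*-identityʳ C))
        (bounded-nonNegative (proj₂ product-terms-bounded u v 0 0))

      0≤4C = ℝ.0≤x+y (ℝ.0≤x+y 0≤C 0≤C) (ℝ.0≤x+y 0≤C 0≤C)

      product : ∀ N → (powerSum α B N ⊗ conjᴹ (powerSum α B N)) u v ≈ rectangle N N (product-terms u v)
      product N = trans (⊗-congˡ (powerSum α B N) (conj-powerSum N) u v) (powerSum-⊗-powerSum α β B N u v)

-- Uniform mixing, Hadamard limits, and dephased limits.

module Mixing (em : ExcludedMiddle 0ℓ) (F : CompleteOrderedField) (n : ℕ) .{{_ : NonZero n}} where

  open UniformMixing em F hiding (_-_; _^_; _⊗_; I)
  open ComplexAnalysis em F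
  open Matrices ℂ-commutativeRing n
  open Series em F using (fromℝ-cong; fromℝ-*)
  open MatrixExponential em F n using
    (exp-symmetric; exp-comm; exp-unitary; ⊗-⇝; conj-cong; conj-*; conj-fromℝ)
  open ℝ using (½)
  module ℝ-I = IdentityMatrix ℝ.commutativeRing
  module ℝ-Sum = Algebra.Properties.Semiring.Sum ℝ.semiring

  0≤sum : ∀ {k} {f : Fin k → ℝ} → (∀ i → ℝ.0# ℝ.≤ f i) → ℝ.0# ℝ.≤ ℝ.sum f
  0≤sum {zero}  0≤f = ℝ.≤-refl
  0≤sum {suc k} 0≤f = ℝ.0≤x+y (0≤f zero) (0≤sum (0≤f ∘ suc))

  term≤sum : ∀ {k} {f : Fin k → ℝ} → (∀ i → ℝ.0# ℝ.≤ f i) → ∀ i → f i ℝ.≤ ℝ.sum f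
  term≤sum {suc k} {f} 0≤f zero    = ℝ.≤-by
    (ℝ.solve 2 (λ a s → a ℝ.:+ s ℝ.:- a ℝ.:= s) ℝ.refl (f zero) (ℝ.sum (f ∘ suc))) (0≤sum (0≤f ∘ suc))
  term≤sum {suc k} {f} 0≤f (suc i) = ℝ.≤-trans (term≤sum (0≤f ∘ suc) i) (ℝ.≤-by
    (ℝ.solve 2 (λ a s → a ℝ.:+ s ℝ.:- s ℝ.:= a) ℝ.refl (f zero) (ℝ.sum (f ∘ suc))) (0≤f zero))

  sum≤ : ∀ {k} {f : Fin k → ℝ} {c} → (∀ i → f i ℝ.≤ c) → ℝ.sum f ℝ.≤ ℝ.fromℕ k ℝ.* c
  sum≤ {zero}  {c = c} f≤c = ℝ.≤-reflexive (ℝ.sym (ℝ.zeroˡ c))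
  sum≤ {suc k} {c = c} f≤c = ℝ.≤-trans (ℝ.+-mono-≤ (f≤c zero) (sum≤ (f≤c ∘ suc)))
    (ℝ.≤-reflexive (ℝ.solve 2 (λ n c → c ℝ.:+ n ℝ.:* c ℝ.:= (ℝ.con (+ 1) ℝ.:+ n) ℝ.:* c) ℝ.refl (ℝ.fromℕ k) c))

  re-sum : ∀ {k} (f : Fin k → ℂ) → re (sum f) ℝ.≈ ℝ.sum (λ i → re (f i))
  re-sum {zero}  f = ℝ.refl
  re-sum {suc k} f = ℝ.+-congˡ (re-sum (f ∘ suc))

  ‖‖<⇒bounded : ∀ (x : Fin n → ℂ) {ε} → ℝ.0# ℝ.≤ ε → ‖ x ‖ ℝ.< ε → ∀ v → Bounded (x v) (ε ℝ.+ ε)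
  ‖‖<⇒bounded x 0≤ε ‖x‖<ε v = ∣z∣²≤c²⇒bounded 0≤ε (ℝ.≤-trans
    (term≤sum (λ v → ∣z∣²-nonNegative (x v)) v)
    (√x<ε⇒x≤ε² (0≤sum (λ v → ∣z∣²-nonNegative (x v))) ‖x‖<ε))

  √-unique : ∀ {x y} → ℝ.0# ℝ.≤ y → y ℝ.* y ℝ.≈ x → √ x ℝ.≈ y
  √-unique {x} {y} 0≤y y²≈x = ℝ.antisym
    (ℝ.≤-squares 0≤y (ℝ.≤-reflexive (ℝ.trans (√-square 0≤x) (ℝ.sym y²≈x))))
    (ℝ.≤-squares (√-nonNegative 0≤x) (ℝ.≤-reflexive (ℝ.trans y²≈x (ℝ.sym (√-square 0≤x)))))
    where
    0≤x = ℝ.≤-respʳ-≈ y²≈x (ℝ.0≤x*x y)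

  z*conj[z] : ∀ z → z * conj z ≈ fromℝ ∣ z ∣²
  z*conj[z] z =
    ℝ.solve 2 (λ a b → a ℝ.:* a ℝ.:- b ℝ.:* (ℝ.:- b) ℝ.:= a ℝ.:* a ℝ.:+ b ℝ.:* b) ℝ.refl (re z) (im z) ,
    ℝ.solve 2 (λ a b → a ℝ.:* (ℝ.:- b) ℝ.:+ b ℝ.:* a ℝ.:= ℝ.con +0) ℝ.refl (re z) (im z)

  N N⁻¹ √N : ℂ
  N   = fromℝ (ℝ.fromℕ n)
  N⁻¹ = fromℝ (ℝ.fromℕ n ℝ.⁻¹)
  √N  = fromℝ (√ (ℝ.fromℕ n))

  0<n : ℝ.0# ℝ.< ℝ.fromℕ n
  0<n = ℝ.0<fromℕ n

  N*N⁻¹≈1 : N * N⁻¹ ≈ 1#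
  N*N⁻¹≈1 = trans (sym (fromℝ-* _ _)) (fromℝ-cong (ℝ.*-inverseʳ _ (ℝ.0<⇒≉0 0<n)))

  scaled-product : ∀ z w → √N * z * conj (√N * w) ≈ N * (z * conj w)
  scaled-product z w = begin
    √N * z * conj (√N * w)          ≈⟨ *-congˡ {√N * z} (trans (conj-* √N w) (*-congʳ {conj w} (conj-fromℝ _))) ⟩
    √N * z * (√N * conj w)          ≈⟨ solve 3 (λ s z w → s :* z :* (s :* w) := s :* s :* (z :* w)) refl √N z (conj w) ⟩
    √N * √N * (z * conj w)          ≈⟨ *-congʳ {z * conj w} (trans (sym (fromℝ-* _ _)) (fromℝ-cong (√-square (ℝ.0≤fromℕ n)))) ⟩
    N * (z * conj w)                ∎
    where open ≈-Reasoning

  Deviation : SquareMatrix → Fin n → Fin n → ℂ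
  Deviation B u = (B ⊛ 𝐞 u) ∘ᵥ (conjᴹ B ⊛ 𝐞 u) -ᵥ constant N⁻¹

  ⊛-𝐞 : ∀ (B : SquareMatrix) u v → (B ⊛ 𝐞 u) v ≈ B v u
  ⊛-𝐞 B u v = trans (∑-cong n (λ w → *-congˡ {B v w} (I-sym u w))) (sum-*-I u (B v))

  deviation : ∀ (B : SquareMatrix) u v → Deviation B u v ≈ B v u * conj (B v u) - N⁻¹
  deviation B u v = +-congʳ {(- N⁻¹)} (*-cong (⊛-𝐞 B u v) (⊛-𝐞 (conjᴹ B) u v))

  deviation-bounded : ∀ (B : SquareMatrix) u {ε} → ℝ.0# ℝ.≤ ε → ‖ Deviation B u ‖ ℝ.< ε →
                      ∀ v → Bounded (B v u * conj (B v u) - N⁻¹) (ε ℝ.+ ε)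
  deviation-bounded B u 0≤ε small v = bounded-cong (deviation B u v) (‖‖<⇒bounded (Deviation B u) 0≤ε small v)

  -- Summing 2∣xᵥ∣² ≤ (ε/n)² over the n entries gives 2‖x‖² ≤ ε²/n ≤ ε², and the factor 2 makes the
  -- resulting inequality strict.
  bounded⇒‖‖< : ∀ (x : Fin n → ℂ) {ε} → ℝ.0# ℝ.< ε → (∀ v → Bounded (x v) (ε ℝ.* ℝ.fromℕ n ℝ.⁻¹)) → ‖ x ‖ ℝ.< ε
  bounded⇒‖‖< x {ε} 0<ε x≤δ = x<ε²⇒√x<ε (0≤sum (λ v → ∣z∣²-nonNegative (x v))) (ℝ.<⇒≤ 0<ε) (x+x≤c⇒x<c (ℝ.0<x*y 0<ε 0<ε) small)
    where
    i : ℝ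
    i = ℝ.fromℕ n ℝ.⁻¹

    1≤n : ℝ.1# ℝ.≤ ℝ.fromℕ n
    1≤n = ℝ.≤-respˡ-≈ (ℝ.+-identityʳ ℝ.1#) (ℝ.fromℕ-mono-≤ (ℕ.>-nonZero⁻¹ n))

    ni≈1 : ℝ.fromℕ n ℝ.* i ℝ.≈ ℝ.1#
    ni≈1 = ℝ.*-inverseʳ _ (ℝ.0<⇒≉0 0<n)

    i≤1 : i ℝ.≤ ℝ.1#
    i≤1 = ℝ.*-cancelˡ-≤ 0<n (ℝ.≤-respˡ-≈ (ℝ.sym ni≈1) (ℝ.≤-respʳ-≈ (ℝ.sym (ℝ.*-identityʳ _)) 1≤n))

    small : ℝ.sum (λ v → ∣ x v ∣²) ℝ.+ ℝ.sum (λ v → ∣ x v ∣²) ℝ.≤ ε ℝ.* ε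
    small = ℝ.≤-trans
      (ℝ.≤-respˡ-≈ (ℝ-Sum.∑-distrib-+ {n} (λ v → ∣ x v ∣²) (λ v → ∣ x v ∣²))
        (sum≤ (λ v → bounded⇒2∣z∣²≤c² (x≤δ v))))
      (ℝ.≤-trans (ℝ.≤-reflexive (ℝ.trans
          (ℝ.solve 3 (λ n e i → n ℝ.:* (e ℝ.:* i ℝ.:* (e ℝ.:* i)) ℝ.:= n ℝ.:* i ℝ.:* (e ℝ.:* e ℝ.:* i)) ℝ.refl (ℝ.fromℕ n) ε i)
          (ℝ.trans (ℝ.*-congʳ ni≈1) (ℝ.*-identityˡ _))))
        (ℝ.≤-trans (ℝ.*-monoʳ-≤ (ℝ.0≤x*x ε) i≤1) (ℝ.≤-reflexive (ℝ.*-identityʳ _))))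

  -- Convergence is entrywise, whereas mixing asks for one time that serves all vertices; the
  -- largest of finitely many thresholds provides it.
  eventually-all : ∀ {k} {P : Fin k → ℕ → Set} → (∀ i → ∃[ m₀ ] ∀ m → m₀ ℕ.≤ m → P i m) →
                   ∃[ m₀ ] ∀ m → m₀ ℕ.≤ m → ∀ i → P i m
  eventually-all {zero}  h = 0 , λ _ _ ()
  eventually-all {suc k} h =
    let (m₀ , P₀) = h zero
        (m₁ , P₁) = eventually-all (h ∘ suc)
    in m₀ ℕ.⊔ m₁ , λ m m≥ → λ
      { zero    → P₀ m (ℕ.≤-trans (ℕ.m≤m⊔n m₀ m₁) m≥)
      ; (suc i) → P₁ m (ℕ.≤-trans (ℕ.m≤n⊔m m₀ m₁) m≥) i
      }

  -- `Z m` stands for `U` at the m-th mixing time, chosen for ε = ½ᵐ; the sum ½ᵐ + ½ᵐ is this ε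
  -- after the doubling in `Bounded`.
  module _ (Z : ℕ → SquareMatrix) (Z-symmetric : ∀ m u v → Z m u v ≈ Z m v u)
           (Z-unitary : ∀ m → Z m ⊗ conjᴹ (Z m) ≋ I)
           (Z-uniform : ∀ m u v → Bounded (Z m u v * conj (Z m u v) - N⁻¹) (½ ℝ.^ʳ m ℝ.+ ½ ℝ.^ʳ m)) where

    intensity-⇝ : ∀ u v → (λ m → Z m u v * conj (Z m u v)) ⇝ N⁻¹
    intensity-⇝ u v = converges (null-geometric (ℝ.1# ℝ.+ ℝ.1#) λ m → bounded-weaken
      (ℝ.≤-reflexive (ℝ.solve 1 (λ p → p ℝ.:+ p ℝ.:= (ℝ.con (+ 1) ℝ.:+ ℝ.con (+ 1)) ℝ.:* p) ℝ.refl (½ ℝ.^ʳ m)))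
      (Z-uniform m u v))

    -- Already for m = 0 uniformity places ∣z∣² within 1 of 1/n, so ∣z∣² ≤ c for c = 1 + 1/n. As c ≥
    -- 1, also ∣z∣² ≤ c², which bounds both parts of z by c.
    Z-bounded : ∀ m u v → Bounded (Z m u v)
      (ℝ.1# ℝ.+ ℝ.fromℕ n ℝ.⁻¹ ℝ.+ (ℝ.1# ℝ.+ ℝ.fromℕ n ℝ.⁻¹))
    Z-bounded m u v = ∣z∣²≤c²⇒bounded 0≤c (ℝ.≤-trans ∣z∣²≤c c≤c²)
      where
      z = Z m u v
      i = ℝ.fromℕ n ℝ.⁻¹
      c = ℝ.1# ℝ.+ i

      0≤i : ℝ.0# ℝ.≤ i
      0≤i = ℝ.<⇒≤ (ℝ.0<x⁻¹ 0<n)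

      0≤c : ℝ.0# ℝ.≤ c
      0≤c = ℝ.0≤x+y ℝ.0≤1 0≤i

      close : Bounded (z * conj z - N⁻¹) (ℝ.1# ℝ.+ ℝ.1#)
      close = bounded-weaken (ℝ.+-mono-≤ (ℝ.½^-antimono-≤ {n = m} (ℕ.≤⇒≤′ z≤n)) (ℝ.½^-antimono-≤ {n = m} (ℕ.≤⇒≤′ z≤n)))
        (Z-uniform m u v)

      ∣z∣²≤c : ∣ z ∣² ℝ.≤ c
      ∣z∣²≤c = ℝ.≤-respˡ-≈ (proj₁ (z*conj[z] z)) (ℝ.≤-by
        (ℝ.solve 2 (λ p i → ℝ.con (+ 1) ℝ.:+ i ℝ.:- p ℝ.:= ℝ.con (+ 1) ℝ.:- (p ℝ.:- i)) ℝ.refl (re (z * conj z)) i)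
        (proj₂ (∈±-halve (re-bound close))))

      c≤c² : c ℝ.≤ c ℝ.* c
      c≤c² = ℝ.≤-by (ℝ.solve 1 (λ i → (ℝ.con (+ 1) ℝ.:+ i) ℝ.:* (ℝ.con (+ 1) ℝ.:+ i) ℝ.:- (ℝ.con (+ 1) ℝ.:+ i)
        ℝ.:= i ℝ.:* (ℝ.con (+ 1) ℝ.:+ i)) ℝ.refl i) (ℝ.*-nonNegative 0≤i 0≤c)

    module _ {φ : ℕ → ℕ} {W : SquareMatrix} (m≤φm : Extraction φ)
             (Z⇝W : ∀ u v → (λ m → Z (φ m) u v) ⇝ W u v) where

      W-symmetric : ∀ u v → W u v ≈ W v u
      W-symmetric u v = ⇝-unique (Z⇝W u v) (⇝-cong (λ m → Z-symmetric (φ m) v u) refl (Z⇝W v u))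

      W-unitary : W ⊗ conjᴹ W ≋ I
      W-unitary u v = ⇝-unique (⊗-⇝ Z⇝W (λ u v → ⇝-conj (Z⇝W u v)) u v)
        (⇝-cong (λ m → sym (Z-unitary (φ m) u v)) refl (⇝-const (I u v)))

      W-intensity : ∀ u v → W u v * conj (W u v) ≈ N⁻¹
      W-intensity u v = ⇝-unique (⇝-* (Z⇝W u v) (⇝-conj (Z⇝W u v))) (⇝-extract m≤φm (intensity-⇝ u v))

      H : SquareMatrix
      H = √N ∙ᴹ W

      H-modulus : ∀ u v → ∣ H u v ∣ ℝ.≈ ℝ.1#
      H-modulus u v = √-unique ℝ.0≤1 (ℝ.trans (ℝ.*-identityˡ ℝ.1#) (proj₁ 1≈∣H∣²))
        where
        1≈∣H∣² : 1# ≈ fromℝ ∣ H u v ∣²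
        1≈∣H∣² = begin
          1#                                   ≈⟨ N*N⁻¹≈1 ⟨
          N * N⁻¹                              ≈⟨ *-congˡ {N} (W-intensity u v) ⟨
          N * (W u v * conj (W u v))           ≈⟨ scaled-product (W u v) (W u v) ⟨
          H u v * conj (H u v)                 ≈⟨ z*conj[z] (H u v) ⟩
          fromℝ ∣ H u v ∣²                     ∎
          where open ≈-Reasoning

      H-orthogonal : ∀ u v → (H ⊗ (conjᴹ H ᵀ)) u v ≈ N * I u v
      H-orthogonal u v = begin
        sum (λ w → H u w * conj (H v w))             ≈⟨ ∑-cong n (λ w → term w) ⟩
        sum (λ w → N * (W u w * conj (W w v)))       ≈⟨ *-distribˡ-sum {n} N (λ w → W u w * conj (W w v)) ⟨
        N * (W ⊗ conjᴹ W) u v                        ≈⟨ *-congˡ {N} (W-unitary u v) ⟩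
        N * I u v                                    ∎
        where
        open ≈-Reasoning
        term : ∀ w → H u w * conj (H v w) ≈ N * (W u w * conj (W w v))
        -- Symmetry of the limit turns the adjoint of the Hadamard condition into the plain
        -- conjugate of `W-unitary`.
        term w = trans (scaled-product (W u w) (W v w))
          (*-congˡ {N} (*-congˡ {W u w} (conj-cong (W-symmetric v w))))

      limit-is-hadamard : (λ m → √N ∙ᴹ Z (φ m)) ⟶ᴹ H × SymmetricMatrix H × IsComplexHadamard H
      limit-is-hadamard =
        (λ u v → ⇝⇒⟶ (⇝-* (⇝-const √N) (Z⇝W u v))) ,
        (λ u v → *-congˡ {√N} (W-symmetric u v)) ,
        H-modulus , H-orthogonal

    hadamard-limit : ∃[ φ ] ∃[ H ] ((λ m → √N ∙ᴹ Z (φ m)) ⟶ᴹ H × SymmetricMatrix H × IsComplexHadamard H)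
    hadamard-limit = from-limit (bolzano-weierstrass-matrix {Z = Z} Z-bounded)
      where
      from-limit : ∃[ φ ] ∃[ W ] Extraction φ × (∀ u v → (λ m → Z (φ m) u v) ⇝ W u v) →
                   ∃[ φ ] ∃[ H ] ((λ m → √N ∙ᴹ Z (φ m)) ⟶ᴹ H × SymmetricMatrix H × IsComplexHadamard H)
      from-limit (φ , W , m≤φm , Z⇝W) = φ , √N ∙ᴹ W , limit-is-hadamard m≤φm Z⇝W

  module _ {Z : ℕ → SquareMatrix} {H : SquareMatrix} (√NZ⟶H : (λ m → √N ∙ᴹ Z m) ⟶ᴹ H) where

    √NZ⇝H : ∀ u v → (λ m → √N * Z m u v) ⇝ H u v
    √NZ⇝H u v = ⟶⇒⇝ (√NZ⟶H u v)

    -- ∣Zᵤᵥ∣² is ∣√n Zᵤᵥ∣² / n, and the squared modulus in the numerator tends to ∣Hᵤᵥ∣² = 1.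
    intensity-limit : (∀ u v → ∣ H u v ∣ ℝ.≈ ℝ.1#) → ∀ u v → (λ m → Z m u v * conj (Z m u v)) ⇝ N⁻¹
    intensity-limit unimodular u v = ⇝-cong cancel (trans (*-congˡ {N⁻¹} (∣H∣²≈1)) (*-identityʳ N⁻¹))
      (⇝-* (⇝-const N⁻¹) (⇝-* (√NZ⇝H u v) (⇝-conj (√NZ⇝H u v))))
      where
      open ≈-Reasoning
      cancel : ∀ m → N⁻¹ * (√N * Z m u v * conj (√N * Z m u v))
                     ≈ Z m u v * conj (Z m u v)
      cancel m = begin
        N⁻¹ * (√N * z * conj (√N * z))    ≈⟨ *-congˡ {N⁻¹} (scaled-product z z) ⟩
        N⁻¹ * (N * (z * conj z))          ≈⟨ solve 3 (λ i n z → i :* (n :* z) := n :* i :* z) refl N⁻¹ N (z * conj z) ⟩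
        N * N⁻¹ * (z * conj z)            ≈⟨ *-congʳ {z * conj z} N*N⁻¹≈1 ⟩
        1# * (z * conj z)                 ≈⟨ *-identityˡ (z * conj z) ⟩
        z * conj z                        ∎
        where z = Z m u v

      ∣H∣²≈1 : H u v * conj (H u v) ≈ 1#
      ∣H∣²≈1 = trans (z*conj[z] (H u v)) (fromℝ-cong (ℝ.trans (ℝ.sym (√-square (∣z∣²-nonNegative (H u v))))
        (ℝ.trans (ℝ.*-cong (unimodular u v) (unimodular u v)) (ℝ.*-identityˡ ℝ.1#))))

    ⊗-limit-comm : ∀ (C : SquareMatrix) → (∀ m → C ⊗ Z m ≋ Z m ⊗ C) → C ⊗ H ≋ H ⊗ C
    ⊗-limit-comm C comm u v = ⇝-unique
      (⊗-⇝ (λ u v → ⇝-const (C u v)) √NZ⇝H u v)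
      (⇝-cong (λ m → scaled m) refl (⊗-⇝ √NZ⇝H (λ u v → ⇝-const (C u v)) u v))
      where
      open ≈-Reasoning
      scaled : ∀ m → ((√N ∙ᴹ Z m) ⊗ C) u v ≈ (C ⊗ (√N ∙ᴹ Z m)) u v
      scaled m = begin
        sum (λ w → √N * Z m u w * C w v)      ≈⟨ ∑-cong n (λ w → *-assoc √N (Z m u w) (C w v)) ⟩
        sum (λ w → √N * (Z m u w * C w v))    ≈⟨ *-distribˡ-sum {n} √N (λ w → Z m u w * C w v) ⟨
        √N * (Z m ⊗ C) u v                    ≈⟨ *-congˡ {√N} (comm m u v) ⟨
        √N * (C ⊗ Z m) u v                    ≈⟨ *-distribˡ-sum {n} √N (λ w → C u w * Z m w v) ⟩
        sum (λ w → √N * (C u w * Z m w v))    ≈⟨ ∑-cong n (λ w → solve 3 (λ s m z → s :* (m :* z) := m :* (s :* z)) refl √N (C u w) (Z m w v)) ⟩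
        sum (λ w → C u w * (√N * Z m w v))    ∎

  -- With a first row and column of ones, 𝟏ᵀ M 𝟏 = 𝟏ᵀ M H 𝐞₀ = 𝟏ᵀ H M 𝐞₀ = n M₀₀.
  dephased⇒total : ∀ (B : Matrix ℝ n) {H : SquareMatrix} → (λ u v → fromℝ (B u v)) ⊗ H ≋ H ⊗ (λ u v → fromℝ (B u v)) →
    SymmetricMatrix H → IsComplexHadamard H → Dephased H → ∀ o → toℕ o ≡ 0 →
    ℝ.sum (λ u → ℝ.sum (λ w → B u w)) ℝ.≈ ℝ.fromℕ n ℝ.* B o o
  dephased⇒total B {H} comm H-sym (_ , orthogonal) dephased o o≡0 =
    ℝ.trans (ℝ.sym (ℝ.trans (re-sum (λ u → sum (λ w → Mᶜ u w)))
      (ℝ-Sum.sum-cong-≋ {n} (λ u → re-sum (λ w → Mᶜ u w)))))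
    (ℝ.trans (proj₁ total) (ℝ.sym (proj₁ (fromℝ-* (ℝ.fromℕ n) (B o o)))))
    where
    open ≈-Reasoning

    Mᶜ : SquareMatrix
    Mᶜ u v = fromℝ (B u v)

    -- By symmetry this is the sum of row `w`, that is, its inner product with row `o` of ones;
    -- orthogonality leaves n if `w` is `o` and 0 otherwise.
    column-sum : ∀ w → sum (λ u → H u w) ≈ N * I w o
    column-sum w = begin
      sum (λ u → H u w)                       ≈⟨ ∑-cong n (λ u → term u) ⟩
      sum (λ u → H w u * conj (H o u))        ≈⟨ orthogonal w o ⟩
      N * I w o                               ∎
      where
      term : ∀ u → H u w ≈ H w u * conj (H o u)
      term u = trans (H-sym u w) (sym (trans
        (*-congˡ {H w u} (trans (conj-cong (dephased o u (inj₁ o≡0))) (conj-fromℝ ℝ.1#)))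
        (*-identityʳ (H w u))))

    total : sum (λ u → sum (λ w → Mᶜ u w)) ≈ N * Mᶜ o o
    total = begin
      sum (λ u → sum (λ w → Mᶜ u w))
        ≈⟨ ∑-cong n (λ u → ∑-cong n (λ w → sym (trans (*-congˡ {Mᶜ u w} (dephased w o (inj₂ o≡0))) (*-identityʳ (Mᶜ u w))))) ⟩
      sum (λ u → (Mᶜ ⊗ H) u o)
        ≈⟨ ∑-cong n (λ u → comm u o) ⟩
      sum (λ u → sum (λ w → H u w * Mᶜ w o))
        ≈⟨ ∑-comm {n} {n} (λ u w → H u w * Mᶜ w o) ⟩
      sum (λ w → sum (λ u → H u w * Mᶜ w o))
        ≈⟨ ∑-cong n (λ w → *-distribʳ-sum {n} (Mᶜ w o) (λ u → H u w)) ⟨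
      sum (λ w → sum (λ u → H u w) * Mᶜ w o)
        ≈⟨ ∑-cong n (λ w → trans (*-congʳ {Mᶜ w o} (trans (column-sum w) (*-congˡ {N} (I-sym w o))))
             (*-assoc N (I o w) (Mᶜ w o))) ⟩
      sum (λ w → N * (I o w * Mᶜ w o))
        ≈⟨ *-distribˡ-sum {n} N (λ w → I o w * Mᶜ w o) ⟨
      N * sum (λ w → I o w * Mᶜ w o)
        ≈⟨ *-congˡ {N} (sum-I-* o (λ w → Mᶜ w o)) ⟩
      N * Mᶜ o o
        ∎

  module _ (X : WeightedGraph n) where

    open WeightedGraph X

    A-symmetric : ∀ u v → A u v ℝ.≈ A v u
    A-symmetric u v with adj? u v | adj? v u
    ... | yes u~v | yes _   = weight-sym u~v
    ... | yes u~v | no v≁u  = contradiction (adj-sym u~v) v≁u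
    ... | no u≁v  | yes v~u = contradiction (adj-sym v~u) u≁v
    ... | no _    | no _    = ℝ.refl

    D-symmetric : ∀ u v → D u v ℝ.≈ D v u
    D-symmetric u v with u ≟ v | v ≟ u
    ... | yes ≡.refl | yes _  = ℝ.refl
    ... | yes u≡v    | no v≢u = contradiction (≡.sym u≡v) v≢u
    ... | no u≢v     | yes v≡u = contradiction (≡.sym v≡u) u≢v
    ... | no _       | no _   = ℝ.refl

    matrix-symmetric : ∀ M u v → matrix X M u v ℝ.≈ matrix X M v u
    matrix-symmetric adjacency         u v = A-symmetric u v
    matrix-symmetric laplacian         u v = ℝ.+-cong (D-symmetric u v) (ℝ.-‿cong (A-symmetric u v))
    matrix-symmetric signlessLaplacian u v = ℝ.+-cong (D-symmetric u v) (A-symmetric u v)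

    A-diagonal : ∀ u → A u u ℝ.≈ ℝ.0#
    A-diagonal u with adj? u u
    ... | yes u~u = contradiction u~u (adj-irrefl ≡.refl)
    ... | no _    = ℝ.refl

    A-nonNegative : ∀ u v → ℝ.0# ℝ.≤ A u v
    A-nonNegative u v with adj? u v
    ... | yes u~v = ℝ.<⇒≤ (weight-positive u~v)
    ... | no _    = ℝ.≤-refl

    A-positive : ∀ {u v} → Adj u v → ℝ.0# ℝ.< A u v
    A-positive {u} {v} u~v with adj? u v
    ... | yes u~v = weight-positive u~v
    ... | no u≁v  = contradiction u~v u≁v

    degree-nonNegative : ∀ u → ℝ.0# ℝ.≤ degree u
    degree-nonNegative u = 0≤sum (A-nonNegative u)

    neighbour : ∀ {u v} → Star Adj u v → ¬ u ≡ v → ∃[ w ] Adj u w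
    neighbour Star.ε        u≢v = contradiction ≡.refl u≢v
    neighbour (u~w ◅ _) _   = _ , u~w

    0<x≤y⇒0<y : ∀ {x y} → ℝ.0# ℝ.< x → x ℝ.≤ y → ℝ.0# ℝ.< y
    0<x≤y⇒0<y 0<x x≤y = ℝ.≰⇒> λ y≤0 → ℝ.<⇒≱ 0<x (ℝ.≤-trans x≤y y≤0)

    -- A path from `u` to another vertex begins with an edge at `u`, whose positive weight is one
    -- summand of the degree.
    degree-positive : ∀ {u v} → ¬ u ≡ v → ℝ.0# ℝ.< degree u
    degree-positive {u} {v} u≢v =
      let (w , u~w) = neighbour (connected u v) u≢v
      in 0<x≤y⇒0<y (A-positive u~w) (term≤sum (A-nonNegative u) w)

    module _ (M : MatrixKind) where

      Mᶜ : SquareMatrix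
      Mᶜ u v = fromℝ (matrix X M u v)

      generator : ℝ → SquareMatrix
      generator t = (ⅈ * fromℝ t) ∙ᴹ Mᶜ

      generator-symmetric : ∀ t u v → generator t u v ≈ generator t v u
      generator-symmetric t u v = *-congˡ {ⅈ * fromℝ t} (fromℝ-cong (matrix-symmetric M u v))

      generator-skew : ∀ t u v → conj (generator t u v) ≈ - generator t u v
      generator-skew t u v =
        -- The entry is purely imaginary: its real part simplifies to 0 and so equals its negative.
        -- On the imaginary part `conj` is negation by definition.
        ℝ.solve 2 (λ t m → (ℝ.con +0 ℝ.:* t ℝ.:- ℝ.con (+ 1) ℝ.:* ℝ.con +0) ℝ.:* m
                             ℝ.:- (ℝ.con +0 ℝ.:* ℝ.con +0 ℝ.:+ ℝ.con (+ 1) ℝ.:* t) ℝ.:* ℝ.con +0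
          ℝ.:= ℝ.:- ((ℝ.con +0 ℝ.:* t ℝ.:- ℝ.con (+ 1) ℝ.:* ℝ.con +0) ℝ.:* m
                             ℝ.:- (ℝ.con +0 ℝ.:* ℝ.con +0 ℝ.:+ ℝ.con (+ 1) ℝ.:* t) ℝ.:* ℝ.con +0))
          ℝ.refl t (matrix X M u v) ,
        ℝ.refl

      M-generator-comm : ∀ t → Mᶜ ⊗ generator t ≋ generator t ⊗ Mᶜ
      M-generator-comm t u v = ∑-cong n λ w →
        solve 3 (λ m c k → m :* (c :* k) := c :* m :* k) refl (Mᶜ u w) (ⅈ * fromℝ t) (Mᶜ w v)

      U-symmetric : ∀ t u v → U X M t u v ≈ U X M t v u
      U-symmetric t = exp-symmetric (generator t) (generator-symmetric t)

      U-unitary : ∀ t → U X M t ⊗ conjᴹ (U X M t) ≋ I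
      U-unitary t = exp-unitary (generator t) (generator-skew t)

      M-U-comm : ∀ t → Mᶜ ⊗ U X M t ≋ U X M t ⊗ Mᶜ
      M-U-comm t = exp-comm Mᶜ (generator t) (M-generator-comm t)

      mixing⇒hadamard : EpsilonUniformMixing X M →
                        ∃[ τ ] ∃[ H ] (ScaledLimit X M τ H × SymmetricMatrix H × IsComplexHadamard H)
      mixing⇒hadamard mixing = from-times
        (λ m → proj₁ (mixing (½ ℝ.^ʳ m) (ℝ.0<½^ m))) (λ m → proj₂ (mixing (½ ℝ.^ʳ m) (ℝ.0<½^ m)))
        where
        from-times : (time : ℕ → ℝ) → (∀ m u → ‖ Deviation (U X M (time m)) u ‖ ℝ.< ½ ℝ.^ʳ m) →
                     ∃[ τ ] ∃[ H ] (ScaledLimit X M τ H × SymmetricMatrix H × IsComplexHadamard H)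
        from-times time small = from-limit (hadamard-limit (λ m → U X M (time m))
          (λ m → U-symmetric (time m)) (λ m → U-unitary (time m))
          (λ m u v → deviation-bounded (U X M (time m)) v (ℝ.<⇒≤ (ℝ.0<½^ m)) (small m v) u))
          where
          from-limit : ∃[ φ ] ∃[ H ] ((λ m → √N ∙ᴹ U X M (time (φ m))) ⟶ᴹ H × SymmetricMatrix H × IsComplexHadamard H) →
                       ∃[ τ ] ∃[ H ] (ScaledLimit X M τ H × SymmetricMatrix H × IsComplexHadamard H)
          from-limit (φ , H , limit) = time ∘ φ , H , limit

      hadamard⇒mixing : ∃[ τ ] ∃[ H ] (ScaledLimit X M τ H × SymmetricMatrix H × IsComplexHadamard H) →
                        EpsilonUniformMixing X M
      hadamard⇒mixing (τ , H , scaledLimit , _ , unimodular , _) ε 0<ε =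
        from-time (eventually-all λ u → eventually-all λ v →
          difference-null (intensity-limit {λ m → U X M (τ m)} scaledLimit unimodular v u) δ (ℝ.0<x*y 0<ε (ℝ.0<x⁻¹ 0<n)))
        where
        δ : ℝ
        δ = ε ℝ.* ℝ.fromℕ n ℝ.⁻¹

        from-time : ∃[ m₀ ] (∀ m → m₀ ℕ.≤ m → ∀ u v → Bounded (U X M (τ m) v u * conj (U X M (τ m) v u) - N⁻¹) δ) →
                    ∃[ t ] ∀ u → ‖ Deviation (U X M t) u ‖ ℝ.< ε
        from-time (m , close) = τ m , λ u → bounded⇒‖‖< (Deviation (U X M (τ m)) u) 0<ε λ v →
          bounded-cong (sym (deviation (U X M (τ m)) u v)) (close m ℕ.≤-refl u v)

      total-weight : ∀ {τ H} → ScaledLimit X M τ H → SymmetricMatrix H → IsComplexHadamard H → Dephased H →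
                     ∀ o → toℕ o ≡ 0 →
                     ℝ.sum (λ u → ℝ.sum (λ w → matrix X M u w)) ℝ.≈ ℝ.fromℕ n ℝ.* matrix X M o o
      total-weight {τ} {H} scaledLimit = dephased⇒total (matrix X M)
        (⊗-limit-comm {λ m → U X M (τ m)} scaledLimit Mᶜ (λ m → M-U-comm (τ m)))

    sum-D : ∀ u → ℝ.sum (D u) ℝ.≈ degree u
    sum-D u = ℝ.trans (ℝ-Sum.sum-cong-≋ {n} (λ v → entry (does (u ≟ v)))) (ℝ-I.sum-I-* u (λ _ → degree u))
      where
      entry : ∀ b → (if b then degree u else ℝ.0#) ℝ.≈ (if b then ℝ.1# else ℝ.0#) ℝ.* degree u
      entry true  = ℝ.sym (ℝ.*-identityˡ _)
      entry false = ℝ.sym (ℝ.zeroˡ _)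

    sum-neg : ∀ {k} (f : Fin k → ℝ) → ℝ.sum (λ i → ℝ.- f i) ℝ.≈ ℝ.- ℝ.sum f
    sum-neg {zero}  f = ℝ.sym ℝ.-0#≈0#
    sum-neg {suc k} f = ℝ.trans (ℝ.+-congˡ (sum-neg (f ∘ suc)))
      (ℝ.solve 2 (λ x y → (ℝ.:- x) ℝ.:- y ℝ.:= ℝ.:- (x ℝ.:+ y)) ℝ.refl (f zero) (ℝ.sum (f ∘ suc)))

    sum-L : ∀ u → ℝ.sum (L u) ℝ.≈ ℝ.0#
    sum-L u = ℝ.trans (ℝ-Sum.∑-distrib-+ {n} (D u) (λ v → ℝ.- A u v))
      (ℝ.trans (ℝ.+-cong (sum-D u) (sum-neg (A u))) (ℝ.-‿inverseʳ (degree u)))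

    L-diagonal : ∀ u → L u u ℝ.≈ degree u
    L-diagonal u = ℝ.trans (ℝ.+-cong (D-diagonal u) (ℝ.-‿cong (A-diagonal u)))
      (ℝ.trans (ℝ.+-congˡ ℝ.-0#≈0#) (ℝ.+-identityʳ _))
      where
      D-diagonal : ∀ u → D u u ℝ.≈ degree u
      D-diagonal u with u ≟ u
      ... | yes _  = ℝ.refl
      ... | no u≢u = contradiction ≡.refl u≢u

    -- The second vertex `p` makes the degree of `o` positive, against both values of the total. On
    -- a single vertex both matrices are 0 and the limit (1) is dephased.
    not-dephased : ∀ {o p : Fin n} → ¬ o ≡ p → toℕ o ≡ 0 → ∀ M → M ≡ adjacency ⊎ M ≡ laplacian →
                   ∀ τ H → ScaledLimit X M τ H → SymmetricMatrix H → IsComplexHadamard H → ¬ Dephased H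
    not-dephased {o} o≢p o≡0 adjacency (inj₁ ≡.refl) τ H scaledLimit symmetric hadamard dephased =
      ℝ.0<⇒≉0 (0<x≤y⇒0<y (degree-positive o≢p) (term≤sum degree-nonNegative o)) (ℝ.trans
        (total-weight adjacency scaledLimit symmetric hadamard dephased o o≡0)
        (ℝ.trans (ℝ.*-congˡ (A-diagonal o)) (ℝ.zeroʳ _)))
    not-dephased {o} o≢p o≡0 laplacian (inj₂ ≡.refl) τ H scaledLimit symmetric hadamard dephased =
      ℝ.0<⇒≉0 (ℝ.0<x*y 0<n (degree-positive o≢p)) (ℝ.trans (ℝ.*-congˡ (ℝ.sym (L-diagonal o))) (ℝ.trans
        (ℝ.sym (total-weight laplacian scaledLimit symmetric hadamard dephased o o≡0))
        (ℝ.trans (ℝ-Sum.sum-cong-≋ {n} sum-L) (ℝ-Sum.sum-replicate-zero n))))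

open import Data.Nat.Base using (_≤_)

proposition2 : (em : ExcludedMiddle 0ℓ) (ℝ-field : CompleteOrderedField) →
    let open UniformMixing em ℝ-field in
    (n : ℕ) .{{_ : NonZero n}} (X : WeightedGraph n) (M : MatrixKind) →
    (EpsilonUniformMixing X M
    ⇔ (∃[ τ ] ∃[ H ] (ScaledLimit X M τ H × SymmetricMatrix H × IsComplexHadamard H)))
    × (2 ≤ n → M ≡ adjacency ⊎ M ≡ laplacian →
    ∀ τ H → ScaledLimit X M τ H → SymmetricMatrix H → IsComplexHadamard H → ¬ Dephased H)
proposition2 em ℝ-field n X M =
  mk⇔ (mixing⇒hadamard X M) (hadamard⇒mixing X M) ,
  -- Matching on 2 ≤ n exposes two successors in n, which provides the two distinct vertices.
  λ { (s≤s (s≤s _)) → not-dephased X {zero} {suc zero} (λ ()) ≡.refl M }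
  where open Mixing em ℝ-field n
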